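{- Let $G$ be a connected noncomplete graph of order $n\geq 9$. If $\delta(G)\geq n/4$, then $pc(G)=2$.
   Context: All graphs are finite, simple and undirected; $\delta(G)$ is the minimum degree. In an edge-colored graph, a path is a proper path if no two adjacent (consecutive) edges of the path receive the same color. For a connected graph $G$, the proper connection number $pc(G)$ is the minimum number of colors in an edge-coloring of $G$ (adjacent edges may share colors) such that every pair of distinct vertices of $G$ is joined by at least one proper path. -}

module Defs where

open import Data.Nat using (ℕ; zero; suc; _+_; _*_; _≤_)
open import Data.Fin using (Fin)
open import Data.Bool using (Bool; true; false)
open import Data.List using (List; []; _∷_; length; filterᵇ; head; last)
open import Data.List.Relation.Unary.Unique.Propositional using (Unique)
open import Data.Maybe using (Maybe; just)
open import Data.Vec.Functional using (Vector)
open import Data.List using (allFin)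
open import Data.Product using (Σ; ∃; _×_; _,_)
open import Data.Unit using (⊤)
open import Relation.Binary.PropositionalEquality using (_≡_; _≢_)
open import Relation.Nullary using (¬_)

record Graph (n : ℕ) : Set where
  field
    adj     : Fin n → Fin n → Bool
    adj-sym : ∀ u v → adj u v ≡ adj v u
    adj-irr : ∀ v → adj v v ≡ false
open Graph public

Adj : ∀ {n} → Graph n → Fin n → Fin n → Set
Adj G u v = adj G u v ≡ true

degree : ∀ {n} → Graph n → Fin n → ℕ
degree {n} G v = length (filterᵇ (adj G v) (allFin n))

-- δ(G) ≥ n/4, written without division: 4·deg(v) ≥ n for every vertex v
MinDegreeAtLeastQuarter : ∀ {n} → Graph n → Set
MinDegreeAtLeastQuarter {n} G = ∀ v → n ≤ 4 * degree G v

Walk : ∀ {n} → Graph n → List (Fin n) → Set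
Walk G []              = ⊤
Walk G (_ ∷ [])        = ⊤
Walk G (u ∷ v ∷ rest)  = Adj G u v × Walk G (v ∷ rest)

IsPath : ∀ {n} → Graph n → Fin n → Fin n → List (Fin n) → Set
IsPath G u v p = Walk G p × Unique p × head p ≡ just u × last p ≡ just v

Connected : ∀ {n} → Graph n → Set
Connected {n} G = ∀ (u v : Fin n) → ∃ λ p → IsPath G u v p

Complete : ∀ {n} → Graph n → Set
Complete {n} G = ∀ (u v : Fin n) → u ≢ v → Adj G u v

-- an edge-colouring with k colours: a symmetric colour assignment to pairs
-- (only its values on edges matter)
record EdgeColoring {n} (G : Graph n) (k : ℕ) : Set where
  field
    col     : Fin n → Fin n → Fin k
    col-sym : ∀ u v → col u v ≡ col v u
open EdgeColoring public

ProperSeq : ∀ {n k} {G : Graph n} → EdgeColoring G k → List (Fin n) → Set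
ProperSeq c (u ∷ v ∷ w ∷ rest) = col c u v ≢ col c v w × ProperSeq c (v ∷ w ∷ rest)
ProperSeq c _ = ⊤

ProperPath : ∀ {n k} {G : Graph n} → EdgeColoring G k → Fin n → Fin n → List (Fin n) → Set
ProperPath {G = G} c u v p = IsPath G u v p × ProperSeq c p

ProperlyConnectedWith : ∀ {n} → Graph n → ℕ → Set
ProperlyConnectedWith {n} G k =
  Σ (EdgeColoring G k) λ c → ∀ (u v : Fin n) → u ≢ v → ∃ λ p → ProperPath c u v p

pc≡ : ∀ {n} → Graph n → ℕ → Set
pc≡ G k = ProperlyConnectedWith G k × (∀ j → ProperlyConnectedWith G j → k ≤ j)

{-# OPTIONS --safe #-}
module Submission where

open import Defs
open import Algebra.Properties.CommutativeSemigroup using ()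
open import Algebra.Properties.Semiring.Sum using ()
open import Data.Bool using (Bool; true; false; not; _∧_; _∨_; _xor_)
open import Data.Bool.Properties using (∨-comm; xor-comm; ∧-zeroʳ) renaming (_≟_ to _≟ᵇ_)
open import Data.Empty using (⊥; ⊥-elim)
open import Data.Fin using (Fin; zero; suc; _≟_)
open import Data.Fin.Patterns using (0F; 1F; 2F)
open import Data.Fin.Properties using (any?; suc-injective)
open import Data.Fin.Subset.Properties using (anySubset?)
open import Data.List using (List; []; _∷_; length; filterᵇ; head; last) renaming (tabulate to tabulateᴸ)
open import Data.List.Membership.DecPropositional using () renaming (_∈?_ to mem?)
open import Data.List.Membership.Propositional using (_∈_; _∉_)
open import Data.List.Relation.Unary.All using ([])
open import Data.List.Relation.Unary.All.Properties using (¬Any⇒All¬)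
open import Data.List.Relation.Unary.AllPairs using ([]; _∷_)
open import Data.List.Relation.Unary.Any using (here; there)
open import Data.List.Relation.Unary.Unique.Propositional using (Unique)
open import Data.Maybe using (just)
open import Data.Nat using (ℕ; zero; suc; _+_; _*_; _≤_; _<_; z≤n; s≤s; _<?_; _≤?_)
open import Data.Nat.DivMod using (_/_; _%_; m≡m%n+[m/n]*n; m%n<n; m<n*o⇒m/o<n)
open import Data.Nat.Properties hiding (_≟_; suc-injective)
open import Data.Nat.Tactic.RingSolver using (solve-∀)
open import Data.Product using (∃; ∃₂; Σ; _×_; _,_; proj₁; proj₂)
open import Data.Sum using (_⊎_; inj₁; inj₂)
open import Data.Unit using (⊤; tt)
open import Data.Vec using (lookup; tabulate)
open import Data.Vec.Properties using (lookup∘tabulate)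
open import Function using (_∘_; id; flip)
open import Relation.Binary.Construct.Closure.ReflexiveTransitive using (Star; ε; _◅_; _◅◅_; gmap; reverse)
open import Relation.Binary.PropositionalEquality using (_≡_; _≢_; refl; sym; trans; cong; cong₂; subst; _≗_; module ≡-Reasoning)
open import Relation.Nullary using (¬_; Dec; yes; no)
open import Relation.Nullary.Decidable using (⌊_⌋; ¬?; _×-dec_; _⊎-dec_)

open Algebra.Properties.CommutativeSemigroup +-commutativeSemigroup using (x∙yz≈y∙xz; x∙yz≈y∙zx)
open Algebra.Properties.Semiring.Sum +-*-semiring using (sum; sum-cong-≗; ∑-distrib-+; ∑-comm; *-distribʳ-sum)

-- Give the vertices two sides; a proper path made of cut edges in two colours is the same thing as a
-- directed path, if each arc is coloured by the side of its tail.  So it suffices to find a cut whose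
-- bipartite graph H is connected and has an orientation in which any two vertices are comparable by
-- reachability.  Growing such an orientation by ears and bridges only fails at a "tripod": three
-- disjoint sets, each joined to the rest of H by one edge, and a vertex t in none of them.
-- For a maximum cut, a set left by one edge of H is left by at most two edges of G, and hence has more
-- than δ ≥ n/4 vertices.  Three such sets leave room for t alone, and since deg t ≥ 4 one of them, L,
-- contains two neighbours a, b of t; these have a common neighbour c in L.  A maximum cut among those
-- that cut the cycle t a c b produces no tripod: the cycle would lie in one of its sets, together with
-- all of L, which forces δ ≥ 5, and then the centre of the new tripod has degree at most 4.


-- Flipping a set `S` in a cut swaps cut and uncut edges on the boundary of `S` and changes nothing
-- else. In a maximum cut at least half of the edges leaving any set are therefore cut, so one exit
-- in H allows at most two in G, and none in H allows none in G, which makes H connected.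
--
-- The order `n ≥ 9` enters as `⌈ n /4⌉ ≥ 3`: a boundary of two edges lies below `δ`, and a nonempty
-- set of at most `δ` vertices has at least `δ` edges leaving it.
--
-- The obstacle in the second round is that a constrained maximum cut can be compared only with
-- flips that respect the constraint. The argument survives because it flips only sets that are
-- closed in H or left by one edge of H, and neither kind separates the vertices of a cycle of H.
-- This is why a whole cycle is prescribed and not merely its two edges at `t`. The same fact keeps
-- the cycle from being split by the sets of a second tripod.

private
  variable
    n : ℕ

true≢false : ∀ {b} → b ≡ true → b ≡ false → ⊥
true≢false refl ()

⟦_⟧ : Bool → ℕ
⟦ true ⟧  = 1
⟦ false ⟧ = 0

-- Finite sums and Boolean subsets

sum-mono-≤ : ∀ {f g : Fin n → ℕ} → (∀ i → f i ≤ g i) → sum f ≤ sum g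
sum-mono-≤ {zero}  f≤g = z≤n
sum-mono-≤ {suc n} f≤g = +-mono-≤ (f≤g zero) (sum-mono-≤ (f≤g ∘ suc))

sum-mono-< : ∀ {f g : Fin n → ℕ} → (∀ i → f i ≤ g i) → ∀ i → f i < g i → sum f < sum g
sum-mono-< f≤g zero    f<g = +-mono-<-≤ f<g (sum-mono-≤ (f≤g ∘ suc))
sum-mono-< f≤g (suc i) f<g = +-mono-≤-< (f≤g zero) (sum-mono-< (f≤g ∘ suc) i f<g)

sum-zero : ∀ {f : Fin n → ℕ} → (∀ i → f i ≡ 0) → sum f ≡ 0
sum-zero {zero}  f≡0 = refl
sum-zero {suc n} f≡0 = cong₂ _+_ (f≡0 zero) (sum-zero (f≡0 ∘ suc))

sum≡0⇒ : ∀ (f : Fin n → ℕ) → sum f ≡ 0 → ∀ i → f i ≡ 0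
sum≡0⇒ f e zero    = m+n≡0⇒m≡0 _ e
sum≡0⇒ f e (suc i) = sum≡0⇒ (f ∘ suc) (m+n≡0⇒n≡0 (f zero) e) i

sum-single : ∀ {f : Fin n → ℕ} i → (∀ j → j ≢ i → f j ≡ 0) → sum f ≡ f i
sum-single {f = f} zero    f≡0 = trans (cong (f zero +_) (sum-zero λ j → f≡0 (suc j) λ ())) (+-identityʳ _)
sum-single {f = f} (suc i) f≡0 = cong₂ _+_ (f≡0 zero λ ()) (sum-single i λ j j≢i → f≡0 (suc j) λ { refl → j≢i refl })

term≤sum : ∀ (f : Fin n → ℕ) i → f i ≤ sum f
term≤sum f zero    = m≤m+n _ _
term≤sum f (suc i) = ≤-trans (term≤sum (f ∘ suc) i) (m≤n+m _ (f zero))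

two-terms≤sum : ∀ (f : Fin n → ℕ) {i j} → i ≢ j → f i + f j ≤ sum f
two-terms≤sum f {zero}  {zero}  i≢j = ⊥-elim (i≢j refl)
two-terms≤sum f {zero}  {suc j} i≢j = +-monoʳ-≤ (f zero) (term≤sum (f ∘ suc) j)
two-terms≤sum f {suc i} {zero}  i≢j = subst (_≤ sum f) (+-comm (f zero) _) (+-monoʳ-≤ (f zero) (term≤sum (f ∘ suc) i))
two-terms≤sum f {suc i} {suc j} i≢j =
  ≤-trans (two-terms≤sum (f ∘ suc) (i≢j ∘ cong suc)) (m≤n+m _ (f zero))

three-terms≤sum : ∀ (f : Fin n → ℕ) {i j k} → i ≢ j → i ≢ k → j ≢ k → f i + (f j + f k) ≤ sum f
three-terms≤sum f {zero} {zero} p q r = ⊥-elim (p refl)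
three-terms≤sum f {zero} {suc j} {zero} p q r = ⊥-elim (q refl)
three-terms≤sum f {zero} {suc j} {suc k} p q r = +-monoʳ-≤ (f zero) (two-terms≤sum (f ∘ suc) (r ∘ cong suc))
three-terms≤sum f {suc i} {zero} {zero} p q r = ⊥-elim (r refl)
three-terms≤sum f {suc i} {zero} {suc k} p q r =
  subst (_≤ sum f) (x∙yz≈y∙xz (f zero) (f (suc i)) (f (suc k)))
    (+-monoʳ-≤ (f zero) (two-terms≤sum (f ∘ suc) (q ∘ cong suc)))
three-terms≤sum f {suc i} {suc j} {zero} p q r =
  subst (_≤ sum f) (x∙yz≈y∙zx (f zero) (f (suc i)) (f (suc j)))
    (+-monoʳ-≤ (f zero) (two-terms≤sum (f ∘ suc) (p ∘ cong suc)))
three-terms≤sum f {suc i} {suc j} {suc k} p q r =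
  ≤-trans (three-terms≤sum (f ∘ suc) (p ∘ cong suc) (q ∘ cong suc) (r ∘ cong suc)) (m≤n+m _ (f zero))

Sub : ℕ → Set
Sub n = Fin n → Bool

card : Sub n → ℕ
card S = sum λ u → ⟦ S u ⟧

∁ : Sub n → Sub n
∁ S u = not (S u)

_∪_ _∩_ : Sub n → Sub n → Sub n
(S ∪ T) u = S u ∨ T u
(S ∩ T) u = S u ∧ T u

⁅_⁆ : Fin n → Sub n
⁅ x ⁆ u = ⌊ u ≟ x ⌋

⁅⁆-self : ∀ (x : Fin n) → ⁅ x ⁆ x ≡ true
⁅⁆-self x with x ≟ x
... | yes _ = refl
... | no ne = ⊥-elim (ne refl)

⁅⁆-true : ∀ {x u : Fin n} → ⁅ x ⁆ u ≡ true → u ≡ x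
⁅⁆-true {x = x} {u} e with u ≟ x
⁅⁆-true e  | yes p = p
⁅⁆-true () | no _

⁅⁆-false : ∀ {x u : Fin n} → u ≢ x → ⁅ x ⁆ u ≡ false
⁅⁆-false {x = x} {u} ne with u ≟ x
... | yes p = ⊥-elim (ne p)
... | no _ = refl

∁-true : ∀ {S : Sub n} {u} → ∁ S u ≡ true → S u ≡ false
∁-true {S = S} {u} e with S u
... | false = refl

∨-split : ∀ {a b} → a ∨ b ≡ true → a ≡ true ⊎ b ≡ true
∨-split {true}  _ = inj₁ refl
∨-split {false} e = inj₂ e

∨-true₁ : ∀ {a} b → a ≡ true → a ∨ b ≡ true
∨-true₁ b refl = refl

∨-true₂ : ∀ a {b} → b ≡ true → a ∨ b ≡ true
∨-true₂ true  _ = refl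
∨-true₂ false e = e

∨-false : ∀ {a b} → a ∨ b ≡ false → a ≡ false × b ≡ false
∨-false {false} e = refl , e

∨-false⁺ : ∀ {a b} → a ≡ false → b ≡ false → a ∨ b ≡ false
∨-false⁺ refl refl = refl

∧-true : ∀ {a b} → a ∧ b ≡ true → a ≡ true × b ≡ true
∧-true {true} e = refl , e

∧-true⁺ : ∀ {a b} → a ≡ true → b ≡ true → a ∧ b ≡ true
∧-true⁺ refl refl = refl

not-false : ∀ {a} → a ≡ false → not a ≡ true
not-false refl = refl

bool-dichotomy : ∀ b → b ≡ true ⊎ b ≡ false
bool-dichotomy true  = inj₁ refl
bool-dichotomy false = inj₂ refl

disjoint-sym : ∀ {S T : Sub n} → (∀ {u} → T u ≡ true → S u ≡ false) → ∀ {u} → S u ≡ true → T u ≡ false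
disjoint-sym {T = T} T∩S {u} u∈S with bool-dichotomy (T u)
... | inj₁ u∈T = ⊥-elim (true≢false u∈S (T∩S u∈T))
... | inj₂ u∉T = u∉T

⟦⟧≤1 : ∀ b → ⟦ b ⟧ ≤ 1
⟦⟧≤1 true  = ≤-refl
⟦⟧≤1 false = z≤n

⟦⟧-mono : ∀ {a b} → (a ≡ true → b ≡ true) → ⟦ a ⟧ ≤ ⟦ b ⟧
⟦⟧-mono {true}  f rewrite f refl = ≤-refl
⟦⟧-mono {false} f = z≤n

card≤n : ∀ (S : Sub n) → card S ≤ n
card≤n {zero}  S = z≤n
card≤n {suc n} S = +-mono-≤ (⟦⟧≤1 (S zero)) (card≤n (S ∘ suc))

card-mono : ∀ {S T : Sub n} → (∀ u → S u ≡ true → T u ≡ true) → card S ≤ card T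
card-mono S⊆T = sum-mono-≤ λ u → ⟦⟧-mono (S⊆T u)

card-mono-< : ∀ {S T : Sub n} → (∀ u → S u ≡ true → T u ≡ true) → ∀ x → S x ≡ false → T x ≡ true → card S < card T
card-mono-< {S = S} {T} S⊆T x x∉S x∈T = sum-mono-< (λ u → ⟦⟧-mono (S⊆T u)) x lt
  where
  lt : ⟦ S x ⟧ < ⟦ T x ⟧
  lt rewrite x∉S | x∈T = ≤-refl

card-disjoint-∪ : ∀ {S T : Sub n} → (∀ {u} → S u ≡ true → T u ≡ false) → card (S ∪ T) ≡ card S + card T
card-disjoint-∪ {S = S} {T} d = trans (sum-cong-≗ λ u → eq (S u) (T u) (d {u})) (∑-distrib-+ (λ u → ⟦ S u ⟧) (λ u → ⟦ T u ⟧))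
  where
  eq : ∀ a b → (a ≡ true → b ≡ false) → ⟦ a ∨ b ⟧ ≡ ⟦ a ⟧ + ⟦ b ⟧
  eq true  b d rewrite d refl = refl
  eq false b d = refl

card>0 : ∀ {S : Sub n} {x} → S x ≡ true → 1 ≤ card S
card>0 {S = S} {x} x∈S = ≤-trans (subst (λ b → 1 ≤ ⟦ b ⟧) (sym x∈S) ≤-refl) (term≤sum (λ u → ⟦ S u ⟧) x)

-- The fuel `k` bounds the growth `N - μ y` that is still possible. All iterations of the proof
-- terminate by this measure: growing a reachable set, growing an orientation, improving a cut.
saturate : ∀ {a b} {A : Set a} {B : Set b} (μ : A → ℕ) N → (∀ x → μ x ≤ N) →
           (∀ x → B ⊎ (∃ λ y → μ x < μ y)) → A → B
saturate {A = A} {B} μ N μ≤N step x = go N x (m≤m+n N (μ x))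
  where
  go : ∀ k y → N ≤ k + μ y → B
  go k y le with step y
  go k y le | inj₁ b = b
  go zero y le | inj₂ (z , lt) = ⊥-elim (<-irrefl refl (≤-trans (≤-trans lt (μ≤N z)) le))
  go (suc k) y le | inj₂ (z , lt) =
    go k z (≤-trans le (≤-trans (≤-reflexive (sym (+-suc k (μ y)))) (+-monoʳ-≤ k lt)))

degree-sum : ∀ (G : Graph n) v → degree G v ≡ sum λ w → ⟦ adj G v w ⟧
degree-sum {n} G v = count (adj G v) id
  where
  count : ∀ {m} (p : Fin n → Bool) (g : Fin m → Fin n) → length (filterᵇ p (tabulateᴸ g)) ≡ sum λ i → ⟦ p (g i) ⟧
  count {zero}  p g = refl
  count {suc m} p g with p (g zero)
  ... | true  = cong suc (count p (g ∘ suc))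
  ... | false = count p (g ∘ suc)

-- Simple paths

data Path {A : Set} (R : A → A → Set) : A → A → List A → Set where
  stop : ∀ {u} → Path R u u (u ∷ [])
  step : ∀ {u w v l} → R u w → u ∉ l → Path R w v l → Path R u v (u ∷ l)

module _ {A : Set} {R : A → A → Set} where

  path-from : ∀ {w v u l} → Path R w v l → u ∈ l → ∃ λ l′ → Path R u v l′
  path-from stop           (here refl)  = _ , stop
  path-from p@(step _ _ _) (here refl)  = _ , p
  path-from (step _ _ p)   (there u∈l)  = path-from p u∈l

  path-head : ∀ {u v l} → Path R u v l → u ∈ l
  path-head stop         = here refl
  path-head (step _ _ _) = here refl

  path-last : ∀ {u v l} → Path R u v l → v ∈ l
  path-last stop         = here refl
  path-last (step _ _ p) = there (path-last p)

Arc : ∀ {A : Set} → List A → A → A → Set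
Arc []          u v = ⊥
Arc (a ∷ [])    u v = ⊥
Arc (a ∷ b ∷ l) u v = (u ≡ a × v ≡ b) ⊎ Arc (b ∷ l) u v

module _ {A : Set} where

  arc-∈ : ∀ (l : List A) {u v} → Arc l u v → u ∈ l × v ∈ l
  arc-∈ (a ∷ b ∷ l) (inj₁ (refl , refl)) = here refl , there (here refl)
  arc-∈ (a ∷ b ∷ l) (inj₂ r) with arc-∈ (b ∷ l) r
  ... | u∈ , v∈ = there u∈ , there v∈

  module _ {R : A → A → Set} where

    arc⇒edge : ∀ {a b l u v} → Path R a b l → Arc l u v → R u v
    arc⇒edge (step r _ stop)           (inj₁ (refl , refl)) = r
    arc⇒edge (step r _ (step _ _ _))   (inj₁ (refl , refl)) = r
    arc⇒edge (step _ _ p@(step _ _ _)) (inj₂ e)             = arc⇒edge p e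

    -- An arc and its reverse would make the list revisit a vertex. Orienting an ear along its list
    -- thus never orients an edge both ways.
    arc-antisym : ∀ {a b l u v} → Path R a b l → Arc l u v → Arc l v u → ⊥
    arc-antisym (step r n stop) (inj₁ (refl , refl)) (inj₁ (refl , refl)) = n (here refl)
    arc-antisym (step r n (step _ _ _)) (inj₁ (refl , refl)) (inj₁ (refl , refl)) = n (here refl)
    arc-antisym {l = _ ∷ l} (step r n (step _ _ _)) (inj₁ (refl , refl)) (inj₂ e) = n (proj₂ (arc-∈ l e))
    arc-antisym {l = _ ∷ l} (step r n (step _ _ _)) (inj₂ e) (inj₁ (refl , refl)) = n (proj₂ (arc-∈ l e))
    arc-antisym (step r n p@(step _ _ _)) (inj₂ e) (inj₂ e′) = arc-antisym p e e′

    arc-walk : ∀ {a b l z} → Path R a b l → z ∈ l → Star (Arc l) a z × Star (Arc l) z b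
    arc-walk stop (here refl) = ε , ε
    arc-walk (step r n p) z∈ = whole p z∈
      where
      whole : ∀ {a w b l z} → Path R w b l → z ∈ a ∷ l → Star (Arc (a ∷ l)) a z × Star (Arc (a ∷ l)) z b
      whole stop           (here refl) = ε , inj₁ (refl , refl) ◅ ε
      whole p@(step _ _ _) (here refl) = ε , inj₁ (refl , refl) ◅ gmap id inj₂ (proj₂ (arc-walk p (here refl)))
      whole stop           (there (here refl)) = inj₁ (refl , refl) ◅ ε , ε
      whole p@(step _ _ _) (there z∈) with arc-walk p z∈
      ... | to , from = inj₁ (refl , refl) ◅ gmap id inj₂ to , gmap id inj₂ from

module _ {n : ℕ} where

  _∈?_ : ∀ (u : Fin n) l → Dec (u ∈ l)
  _∈?_ = mem? _≟_

  arc? : ∀ (l : List (Fin n)) u v → Dec (Arc l u v)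
  arc? []          u v = no λ ()
  arc? (a ∷ [])    u v = no λ ()
  arc? (a ∷ b ∷ l) u v = ((u ≟ a) ×-dec (v ≟ b)) ⊎-dec arc? (b ∷ l) u v

  simple-path : ∀ {R : Fin n → Fin n → Set} {u v} → Star R u v → ∃ λ l → Path R u v l
  simple-path ε = _ , stop
  simple-path {u = u} (r ◅ rs) with simple-path rs
  ... | l , p with u ∈? l
  ...   | yes u∈l = path-from p u∈l
  ...   | no  u∉l = _ , step r u∉l p

  members : List (Fin n) → Sub n
  members l u = ⌊ u ∈? l ⌋

  members⁺ : ∀ {l u} → u ∈ l → members l u ≡ true
  members⁺ {l} {u} u∈ with u ∈? l
  ... | yes _ = refl
  ... | no ∉ = ⊥-elim (∉ u∈)

  members⁻ : ∀ {l u} → members l u ≡ true → u ∈ l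
  members⁻ {l} {u} e with u ∈? l
  ... | yes u∈ = u∈

-- Unilateral orientations

module Orientation {n : ℕ} (H : Fin n → Fin n → Bool) (H-sym : ∀ u v → H u v ≡ H v u) where

  record OneExit (F : Sub n) : Set where
    field
      inner outer : Fin n
      inner∈ : F inner ≡ true
      outer∉ : F outer ≡ false
      edge   : H inner outer ≡ true
      only   : ∀ {y q} → F y ≡ true → F q ≡ false → H y q ≡ true → y ≡ inner × q ≡ outer

  -- A genuine obstruction: in any orientation, two of the three exit edges both point out of their
  -- sets or both point into them, and then no directed walk leads from either of these two sets to
  -- the other.
  record Tripod : Set where
    field
      t     : Fin n
      F     : Fin 3 → Sub n
      exit  : ∀ i → OneExit (F i)
      disj  : ∀ {i j} → i ≢ j → ∀ u → F i u ≡ true → F j u ≡ false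
      t∉    : ∀ i → F i t ≡ false

  -- `D` may leave edges of `H` without a direction; reachability uses only the oriented ones.
  record Unilateral : Set₁ where
    field
      D    : Fin n → Fin n → Set
      D?   : ∀ u v → Dec (D u v)
      D⇒H  : ∀ {u v} → D u v → H u v ≡ true
      anti : ∀ {u v} → D u v → D v u → ⊥
      comparable : ∀ u v → Star D u v ⊎ Star D v u

  -- Only the head of an edge is tested, so a walk may start in `W`; statements about all its
  -- vertices assume that the start lies outside.
  Outside : Sub n → Fin n → Fin n → Set
  Outside W u v = H u v ≡ true × W v ≡ false

  record Reach (W : Sub n) (x : Fin n) : Set where
    field
      F      : Sub n
      start  : F x ≡ true
      walk   : ∀ {y} → F y ≡ true → Star (Outside W) x y
      closed : ∀ {y z} → F y ≡ true → H y z ≡ true → W z ≡ false → F z ≡ true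

  Exit : Sub n → Sub n → Fin n → Fin n → Set
  Exit F W u v = F u ≡ true × (F v ≡ false × (W v ≡ false × H u v ≡ true))

  exit? : ∀ F W → Dec (∃₂ (Exit F W))
  exit? F W = any? λ u → any? λ v → (F u ≟ᵇ true) ×-dec ((F v ≟ᵇ false) ×-dec ((W v ≟ᵇ false) ×-dec (H u v ≟ᵇ true)))

  reach : ∀ W x → Reach W x
  reach W x = saturate (card ∘ proj₁) n (card≤n ∘ proj₁) grow (⁅ x ⁆ , ⁅⁆-self x , λ y∈ → subst (Star _ x) (sym (⁅⁆-true y∈)) ε)
    where
    State : Set
    State = ∃ λ F → F x ≡ true × (∀ {y} → F y ≡ true → Star (Outside W) x y)
    grow : ∀ (s : State) → Reach W x ⊎ (∃ λ (s′ : State) → card (proj₁ s) < card (proj₁ s′))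
    grow (F , start , walk) with exit? F W
    ... | no none = inj₁ record
      { F = F ; start = start ; walk = walk
      ; closed = λ {y} {z} y∈ h z∉W → closed y z y∈ h z∉W }
      where
      closed : ∀ y z → F y ≡ true → H y z ≡ true → W z ≡ false → F z ≡ true
      closed y z y∈ h z∉W with bool-dichotomy (F z)
      ... | inj₁ z∈ = z∈
      ... | inj₂ z∉ = ⊥-elim (none (y , z , y∈ , z∉ , z∉W , h))
    ... | yes (y , z , y∈ , z∉ , z∉W , h) = inj₂ ((F ∪ ⁅ z ⁆ , ∨-true₁ _ start , walk′) ,
            card-mono-< (λ u u∈ → ∨-true₁ _ u∈) z z∉ (∨-true₂ (F z) (⁅⁆-self z)))
      where
      walk′ : ∀ {u} → (F ∪ ⁅ z ⁆) u ≡ true → Star (Outside W) x u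
      walk′ {u} u∈ with ∨-split {F u} u∈
      ... | inj₁ u∈F = walk u∈F
      ... | inj₂ u≡z with ⁅⁆-true u≡z
      ...   | refl = walk y∈ ◅◅ ((h , z∉W) ◅ ε)

  outside-path : ∀ {W x y l} → W x ≡ false → Path (Outside W) x y l → ∀ {z} → z ∈ l → W z ≡ false
  outside-path x∉ stop         (here refl) = x∉
  outside-path x∉ (step _ _ _) (here refl) = x∉
  outside-path x∉ (step (_ , w∉) _ p) (there z∈) = outside-path w∉ p z∈

  outside-reverse : ∀ {W x y} → W x ≡ false → Star (Outside W) x y → Star (Outside W) y x
  outside-reverse x∉ ε = ε
  outside-reverse x∉ ((h , w∉) ◅ p) = outside-reverse w∉ p ◅◅ ((trans (H-sym _ _) h , x∉) ◅ ε)

  reach-∉ : ∀ {W x} (ρ : Reach W x) → W x ≡ false → ∀ {y} → Reach.F ρ y ≡ true → W y ≡ false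
  reach-∉ ρ x∉ y∈ = outside-end x∉ (Reach.walk ρ y∈)
    where
    outside-end : ∀ {W x y} → W x ≡ false → Star (Outside W) x y → W y ≡ false
    outside-end x∉ ε = x∉
    outside-end x∉ ((_ , w∉) ◅ p) = outside-end w∉ p

  reach-walk : ∀ {W x y} (ρ : Reach W x) {z} → Reach.F ρ z ≡ true → Star (Outside W) z y → Reach.F ρ y ≡ true
  reach-walk ρ z∈ ε = z∈
  reach-walk ρ z∈ ((h , w∉) ◅ p) = reach-walk ρ (Reach.closed ρ z∈ h w∉) p

  -- A partial orientation, supported on S, that runs from r to t; the vertices of X are set aside for
  -- later, and the exits from S to unexplored territory all lie in the strong component of t.
  record Core (X : Sub n) : Set₁ where
    field
      S    : Sub n
      D    : Fin n → Fin n → Set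
      D?   : ∀ u v → Dec (D u v)
      D⇒H  : ∀ {u v} → D u v → H u v ≡ true
      anti : ∀ {u v} → D u v → D v u → ⊥
      supp : ∀ {u v} → D u v → S u ≡ true × S v ≡ true
      r t  : Fin n
      t∈S  : S t ≡ true
      from-r     : ∀ {u} → S u ≡ true → Star D r u
      to-t       : ∀ {u} → S u ≡ true → Star D u t
      comparable : ∀ {u v} → S u ≡ true → S v ≡ true → Star D u v ⊎ Star D v u
      S∩X        : ∀ {u} → S u ≡ true → X u ≡ false
      exits      : ∀ {u v} → S u ≡ true → S v ≡ false → X v ≡ false → H u v ≡ true → Star D t u
      X-exits    : ∀ {u v} → S u ≡ true → X v ≡ true → H u v ≡ true → Star D u r
      X-sealed   : ∀ {u v} → X v ≡ true → X u ≡ false → H u v ≡ true → S u ≡ true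

  -- The part behind t, which is the third set of a tripod if two bridges lead on from S.
  record Zone {X} (c : Core X) : Set where
    open Core c
    field
      Z    : Sub n
      exit : OneExit Z
      Z⊆   : ∀ {u} → Z u ≡ true → (S ∪ X) u ≡ true
      t∉Z  : Z t ≡ false

  Done : ∀ {X} → Core X → Set
  Done {X} c = ¬ ∃₂ (Exit (Core.S c) X)

  SingleExit : ∀ {X} → Core X → Fin n → Fin n → Set
  SingleExit {X} c p x = Exit (Core.S c) X p x × (∀ {u v} → Exit (Core.S c) X u v → u ≡ p × v ≡ x)

  module _ {X : Sub n} (c : Core X) where
    open Core c

    -- The bridge is oriented away from `S` and `x` becomes the new sink `t`. Every later exit
    -- starts at `x`, since the bridge was the only exit of `S`. All that lies behind, `X` included,
    -- is left by the bridge alone and so forms a zone.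
    advance : ∀ {p x} → SingleExit c p x → Σ (Core X) λ c′ → Zone c′ × card S < card (Core.S c′)
    advance {p} {x} ((p∈ , x∉ , x∉X , h) , only) = core , zone , card-mono-< (λ u u∈ → ∨-true₁ _ u∈) x x∉ x∈′
      where
      S′ = S ∪ ⁅ x ⁆
      x∈′ : S′ x ≡ true
      x∈′ = ∨-true₂ (S x) (⁅⁆-self x)
      D′ : Fin n → Fin n → Set
      D′ u v = D u v ⊎ (u ≡ p × v ≡ x)
      mono : ∀ {u v} → Star D u v → Star D′ u v
      mono = gmap id inj₁
      t⇝p : Star D t p
      t⇝p = exits p∈ x∉ x∉X h
      S⇝x : ∀ {u} → S u ≡ true → Star D′ u x
      S⇝x u∈ = mono (to-t u∈ ◅◅ t⇝p) ◅◅ (inj₂ (refl , refl) ◅ ε)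
      split : ∀ {u} → S′ u ≡ true → S u ≡ true ⊎ u ≡ x
      split {u} u∈ with ∨-split {S u} u∈
      ... | inj₁ u∈S = inj₁ u∈S
      ... | inj₂ e   = inj₂ (⁅⁆-true e)
      anti′ : ∀ {u v} → D′ u v → D′ v u → ⊥
      anti′ (inj₁ d) (inj₁ d′) = anti d d′
      anti′ (inj₁ d) (inj₂ (refl , refl)) = true≢false (proj₁ (supp d)) x∉
      anti′ (inj₂ (refl , refl)) (inj₁ d) = true≢false (proj₁ (supp d)) x∉
      anti′ (inj₂ (refl , refl)) (inj₂ (refl , _)) = true≢false p∈ x∉
      supp′ : ∀ {u v} → D′ u v → S′ u ≡ true × S′ v ≡ true
      supp′ (inj₁ d) = ∨-true₁ _ (proj₁ (supp d)) , ∨-true₁ _ (proj₂ (supp d))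
      supp′ (inj₂ (refl , refl)) = ∨-true₁ _ p∈ , x∈′
      D⇒H′ : ∀ {u v} → D′ u v → H u v ≡ true
      D⇒H′ (inj₁ d) = D⇒H d
      D⇒H′ (inj₂ (refl , refl)) = h
      from′ : ∀ {u} → S′ u ≡ true → Star D′ r u
      from′ u∈ with split u∈
      ... | inj₁ u∈S = mono (from-r u∈S)
      ... | inj₂ refl = mono (from-r p∈) ◅◅ (inj₂ (refl , refl) ◅ ε)
      to′ : ∀ {u} → S′ u ≡ true → Star D′ u x
      to′ u∈ with split u∈
      ... | inj₁ u∈S = S⇝x u∈S
      ... | inj₂ refl = ε
      comp′ : ∀ {u v} → S′ u ≡ true → S′ v ≡ true → Star D′ u v ⊎ Star D′ v u
      comp′ u∈ v∈ with split u∈ | split v∈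
      ... | inj₂ refl | _ = inj₂ (to′ v∈)
      ... | _ | inj₂ refl = inj₁ (to′ u∈)
      ... | inj₁ u∈S | inj₁ v∈S with comparable u∈S v∈S
      ...   | inj₁ w = inj₁ (mono w)
      ...   | inj₂ w = inj₂ (mono w)
      disj′ : ∀ {u} → S′ u ≡ true → X u ≡ false
      disj′ u∈ with split u∈
      ... | inj₁ u∈S = S∩X u∈S
      ... | inj₂ refl = x∉X
      exits′ : ∀ {u v} → S′ u ≡ true → S′ v ≡ false → X v ≡ false → H u v ≡ true → Star D′ x u
      exits′ {u} {v} u∈ v∉ v∉X h′ with split u∈
      ... | inj₂ refl = ε
      ... | inj₁ u∈S with only (u∈S , proj₁ (∨-false {S v} v∉) , v∉X , h′)
      ...   | refl , refl = ⊥-elim (true≢false x∈′ v∉)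
      Xexits′ : ∀ {u v} → S′ u ≡ true → X v ≡ true → H u v ≡ true → Star D′ u r
      Xexits′ u∈ v∈X h′ with split u∈
      ... | inj₁ u∈S = mono (X-exits u∈S v∈X h′)
      ... | inj₂ refl = ⊥-elim (true≢false (X-sealed v∈X x∉X h′) x∉)
      core : Core X
      core = record
        { S = S′ ; D = D′ ; D? = λ u v → D? u v ⊎-dec ((u ≟ p) ×-dec (v ≟ x))
        ; D⇒H = D⇒H′ ; anti = anti′ ; supp = supp′ ; r = r ; t = x ; t∈S = x∈′
        ; from-r = from′ ; to-t = to′ ; comparable = comp′ ; S∩X = disj′
        ; exits = exits′ ; X-exits = Xexits′ ; X-sealed = λ v∈ u∉ h′ → ∨-true₁ _ (X-sealed v∈ u∉ h′) }
      only′ : ∀ {y q} → (S ∪ X) y ≡ true → (S ∪ X) q ≡ false → H y q ≡ true → y ≡ p × q ≡ x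
      only′ {y} {q} y∈ q∉ h′ with ∨-split {S y} y∈ | ∨-false {S q} q∉
      ... | inj₁ y∈S | q∉S , q∉X = only (y∈S , q∉S , q∉X , h′)
      ... | inj₂ y∈X | q∉S , q∉X = ⊥-elim (true≢false (X-sealed y∈X q∉X (trans (H-sym q y) h′)) q∉S)
      zone : Zone core
      zone = record
        { Z = S ∪ X
        ; exit = record { inner = p ; outer = x ; inner∈ = ∨-true₁ _ p∈ ; outer∉ = ∨-false⁺ x∉ x∉X ; edge = h ; only = only′ }
        ; Z⊆ = λ {u} u∈ → widen u (∨-split {S u} u∈)
        ; t∉Z = ∨-false⁺ x∉ x∉X }
        where
        widen : ∀ u → S u ≡ true ⊎ X u ≡ true → (S′ ∪ X) u ≡ true
        widen u (inj₁ e) = ∨-true₁ _ (∨-true₁ _ e)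
        widen u (inj₂ e) = ∨-true₂ (S′ u) e

    record Ear : Set₁ where
      field
        core  : Core X
        grows : card S < card (Core.S core)
        S⊆    : ∀ {u} → S u ≡ true → Core.S core u ≡ true
        same-t : Core.t core ≡ t
        same-r : Core.r core ≡ r

    -- The ear closes the walk from `t` to `p`, along the path, to `q` and back to `t`. Its vertices
    -- therefore join the strong component of `t`, and `r` and `t` can stay. The last hypothesis
    -- prevents the ear from returning along the edge by which it left.
    add-ear : ∀ {p x y q l} → Exit S X p x → Path (Outside (S ∪ X)) x y l →
              S q ≡ true → H y q ≡ true → ¬ (y ≡ x × q ≡ p) → Ear
    add-ear {p} {x} {y} {q} {l} (p∈ , x∉ , x∉X , h) path q∈ hyq distinct = record
      { core = core ; grows = card-mono-< (λ u u∈ → ∨-true₁ _ u∈) x x∉ (l⊆ (path-head path))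
      ; S⊆ = λ u∈ → ∨-true₁ _ u∈ ; same-t = refl ; same-r = refl }
      where
      S′ = S ∪ members l
      l⊆ : ∀ {u} → u ∈ l → S′ u ≡ true
      l⊆ {u} u∈ = ∨-true₂ (S u) (members⁺ u∈)
      l∉ : ∀ {u} → u ∈ l → S u ≡ false × X u ≡ false
      l∉ {u} u∈ = ∨-false {S u} (outside-path (∨-false⁺ x∉ x∉X) path u∈)
      clash : ∀ {u} {C : Set} → S u ≡ true → u ∈ l → C
      clash u∈ u∈l = ⊥-elim (true≢false u∈ (proj₁ (l∉ u∈l)))
      D′ : Fin n → Fin n → Set
      D′ u v = D u v ⊎ (Arc l u v ⊎ ((u ≡ p × v ≡ x) ⊎ (u ≡ y × v ≡ q)))
      mono : ∀ {u v} → Star D u v → Star D′ u v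
      mono = gmap id inj₁
      along : ∀ {u v} → Star (Arc l) u v → Star D′ u v
      along = gmap id (inj₂ ∘ inj₁)
      x∈ = path-head path
      y∈ = path-last path
      anti′ : ∀ {u v} → D′ u v → D′ v u → ⊥
      anti′ (inj₁ d) (inj₁ d′) = anti d d′
      anti′ (inj₁ d) (inj₂ (inj₁ a)) = clash (proj₂ (supp d)) (proj₁ (arc-∈ l a))
      anti′ (inj₁ d) (inj₂ (inj₂ (inj₁ (refl , refl)))) = clash (proj₁ (supp d)) x∈
      anti′ (inj₁ d) (inj₂ (inj₂ (inj₂ (refl , refl)))) = clash (proj₂ (supp d)) y∈
      anti′ (inj₂ (inj₁ a)) (inj₁ d) = clash (proj₁ (supp d)) (proj₂ (arc-∈ l a))
      anti′ (inj₂ (inj₁ a)) (inj₂ (inj₁ a′)) = arc-antisym path a a′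
      anti′ (inj₂ (inj₁ a)) (inj₂ (inj₂ (inj₁ (refl , refl)))) = clash p∈ (proj₂ (arc-∈ l a))
      anti′ (inj₂ (inj₁ a)) (inj₂ (inj₂ (inj₂ (refl , refl)))) = clash q∈ (proj₁ (arc-∈ l a))
      anti′ (inj₂ (inj₂ (inj₁ (refl , refl)))) (inj₁ d) = clash (proj₁ (supp d)) x∈
      anti′ (inj₂ (inj₂ (inj₁ (refl , refl)))) (inj₂ (inj₁ a)) = clash p∈ (proj₂ (arc-∈ l a))
      anti′ (inj₂ (inj₂ (inj₁ (refl , refl)))) (inj₂ (inj₂ (inj₁ (refl , _)))) = clash p∈ x∈
      anti′ (inj₂ (inj₂ (inj₁ (refl , refl)))) (inj₂ (inj₂ (inj₂ (e , e′)))) = distinct (sym e , sym e′)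
      anti′ (inj₂ (inj₂ (inj₂ (refl , refl)))) (inj₁ d) = clash (proj₂ (supp d)) y∈
      anti′ (inj₂ (inj₂ (inj₂ (refl , refl)))) (inj₂ (inj₁ a)) = clash q∈ (proj₁ (arc-∈ l a))
      anti′ (inj₂ (inj₂ (inj₂ (refl , refl)))) (inj₂ (inj₂ (inj₁ (e , e′)))) = distinct (e′ , e)
      anti′ (inj₂ (inj₂ (inj₂ (refl , refl)))) (inj₂ (inj₂ (inj₂ (refl , _)))) = clash q∈ y∈
      supp′ : ∀ {u v} → D′ u v → S′ u ≡ true × S′ v ≡ true
      supp′ (inj₁ d) = ∨-true₁ _ (proj₁ (supp d)) , ∨-true₁ _ (proj₂ (supp d))
      supp′ (inj₂ (inj₁ a)) = l⊆ (proj₁ (arc-∈ l a)) , l⊆ (proj₂ (arc-∈ l a))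
      supp′ (inj₂ (inj₂ (inj₁ (refl , refl)))) = ∨-true₁ _ p∈ , l⊆ x∈
      supp′ (inj₂ (inj₂ (inj₂ (refl , refl)))) = l⊆ y∈ , ∨-true₁ _ q∈
      D⇒H′ : ∀ {u v} → D′ u v → H u v ≡ true
      D⇒H′ (inj₁ d) = D⇒H d
      D⇒H′ (inj₂ (inj₁ a)) = proj₁ (arc⇒edge path a)
      D⇒H′ (inj₂ (inj₂ (inj₁ (refl , refl)))) = h
      D⇒H′ (inj₂ (inj₂ (inj₂ (refl , refl)))) = hyq
      p⇝ : ∀ {u} → u ∈ l → Star D′ p u
      p⇝ u∈ = inj₂ (inj₂ (inj₁ (refl , refl))) ◅ along (proj₁ (arc-walk path u∈))
      ⇝q : ∀ {u} → u ∈ l → Star D′ u q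
      ⇝q u∈ = along (proj₂ (arc-walk path u∈)) ◅◅ (inj₂ (inj₂ (inj₂ (refl , refl))) ◅ ε)
      t⇝ : ∀ {u} → u ∈ l → Star D′ t u
      t⇝ u∈ = mono (exits p∈ x∉ x∉X h) ◅◅ p⇝ u∈
      split : ∀ {u} → S′ u ≡ true → S u ≡ true ⊎ u ∈ l
      split {u} u∈ with ∨-split {S u} u∈
      ... | inj₁ u∈S = inj₁ u∈S
      ... | inj₂ e   = inj₂ (members⁻ e)
      from′ : ∀ {u} → S′ u ≡ true → Star D′ r u
      from′ u∈ with split u∈
      ... | inj₁ u∈S = mono (from-r u∈S)
      ... | inj₂ u∈l = mono (from-r p∈) ◅◅ p⇝ u∈l
      to′ : ∀ {u} → S′ u ≡ true → Star D′ u t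
      to′ u∈ with split u∈
      ... | inj₁ u∈S = mono (to-t u∈S)
      ... | inj₂ u∈l = ⇝q u∈l ◅◅ mono (to-t q∈)
      comp′ : ∀ {u v} → S′ u ≡ true → S′ v ≡ true → Star D′ u v ⊎ Star D′ v u
      comp′ u∈ v∈ with split u∈ | split v∈
      ... | inj₂ u∈l | _ = inj₂ (to′ v∈ ◅◅ t⇝ u∈l)
      ... | _ | inj₂ v∈l = inj₁ (to′ u∈ ◅◅ t⇝ v∈l)
      ... | inj₁ u∈S | inj₁ v∈S with comparable u∈S v∈S
      ...   | inj₁ w = inj₁ (mono w)
      ...   | inj₂ w = inj₂ (mono w)
      disj′ : ∀ {u} → S′ u ≡ true → X u ≡ false
      disj′ u∈ with split u∈
      ... | inj₁ u∈S = S∩X u∈S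
      ... | inj₂ u∈l = proj₂ (l∉ u∈l)
      exits′ : ∀ {u v} → S′ u ≡ true → S′ v ≡ false → X v ≡ false → H u v ≡ true → Star D′ t u
      exits′ {u} {v} u∈ v∉ v∉X h′ with split u∈
      ... | inj₁ u∈S = mono (exits u∈S (proj₁ (∨-false {S v} v∉)) v∉X h′)
      ... | inj₂ u∈l = t⇝ u∈l
      Xexits′ : ∀ {u v} → S′ u ≡ true → X v ≡ true → H u v ≡ true → Star D′ u r
      Xexits′ u∈ v∈X h′ with split u∈
      ... | inj₁ u∈S = mono (X-exits u∈S v∈X h′)
      ... | inj₂ u∈l = clash (X-sealed v∈X (proj₂ (l∉ u∈l)) h′) u∈l
      core : Core X
      core = record
        { S = S′ ; D = D′
        ; D? = λ u v → D? u v ⊎-dec (arc? l u v ⊎-dec (((u ≟ p) ×-dec (v ≟ x)) ⊎-dec ((u ≟ y) ×-dec (v ≟ q))))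
        ; D⇒H = D⇒H′ ; anti = anti′ ; supp = supp′ ; r = r ; t = t ; t∈S = ∨-true₁ _ t∈S
        ; from-r = from′ ; to-t = to′ ; comparable = comp′ ; S∩X = disj′
        ; exits = exits′ ; X-exits = Xexits′ ; X-sealed = λ v∈ u∉ h′ → ∨-true₁ _ (X-sealed v∈ u∉ h′) }

    record Side (x : Fin n) : Set where
      field
        ρ    : Reach (S ∪ X) x
        exit : OneExit (Reach.F ρ)
        inner≡x : OneExit.inner exit ≡ x

    -- Whatever `x` reaches outside `S ∪ X` either has a second edge back to `S`, which closes an
    -- ear, or is attached by the edge to `p` alone. It has no edge to `X`, because `X-sealed` lets
    -- only `S` touch `X`.
    explore : ∀ {p x} → Exit S X p x → Ear ⊎ (Σ (Side x) λ σ → OneExit.outer (Side.exit σ) ≡ p)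
    explore {p} {x} e@(p∈ , x∉ , x∉X , h) = decide
      (any? λ y → any? λ q → ((F y ≟ᵇ true) ×-dec ((S q ≟ᵇ true) ×-dec (H y q ≟ᵇ true))) ×-dec ¬? ((y ≟ x) ×-dec (q ≟ p)))
      where
      ρ = reach (S ∪ X) x
      F = Reach.F ρ
      F∉ : ∀ {y} → F y ≡ true → S y ≡ false × X y ≡ false
      F∉ {y} y∈ = ∨-false {S y} (reach-∉ ρ (∨-false⁺ x∉ x∉X) y∈)
      p∉ : F p ≡ false
      p∉ with bool-dichotomy (F p)
      ... | inj₁ p∈F = ⊥-elim (true≢false p∈ (proj₁ (F∉ p∈F)))
      ... | inj₂ e = e
      Return : Fin n → Fin n → Set
      Return y q = (F y ≡ true × (S q ≡ true × H y q ≡ true)) × ¬ (y ≡ x × q ≡ p)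
      only : ¬ ∃₂ Return → ∀ {y q} → F y ≡ true → F q ≡ false → H y q ≡ true → y ≡ x × q ≡ p
      only none {y} {q} y∈ q∉ hyq with bool-dichotomy (S q) | bool-dichotomy (X q)
      ... | inj₂ q∉S | inj₂ q∉X = ⊥-elim (true≢false (Reach.closed ρ y∈ hyq (∨-false⁺ q∉S q∉X)) q∉)
      ... | inj₂ q∉S | inj₁ q∈X = ⊥-elim (true≢false (X-sealed q∈X (proj₂ (F∉ y∈)) hyq) (proj₁ (F∉ y∈)))
      ... | inj₁ q∈S | _ with (y ≟ x) ×-dec (q ≟ p)
      ...   | yes eq = eq
      ...   | no ne  = ⊥-elim (none (y , q , (y∈ , q∈S , hyq) , ne))
      decide : Dec (∃₂ Return) → Ear ⊎ (Σ (Side x) λ σ → OneExit.outer (Side.exit σ) ≡ p)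
      decide (yes (y , q , (y∈ , q∈ , hyq) , distinct)) =
        inj₁ (add-ear e (proj₂ (simple-path (Reach.walk ρ y∈))) q∈ hyq distinct)
      decide (no none) = inj₂ (record
        { ρ = ρ
        ; exit = record { inner = x ; outer = p ; inner∈ = Reach.start ρ ; outer∉ = p∉ ; edge = trans (H-sym x p) h ; only = only none }
        ; inner≡x = refl } , refl)

    data Step : Set₁ where
      done   : Done c → Step
      ear    : Ear → Step
      bridge : ∀ {p x} → SingleExit c p x → Step
      fork   : ∀ {x x′} (σ : Side x) (σ′ : Side x′) →
               (S ∪ X) x ≡ false → (S ∪ X) x′ ≡ false → S (OneExit.outer (Side.exit σ′)) ≡ true →
               Reach.F (Side.ρ σ) x′ ≡ false → Step

    next : Step
    next with exit? S X
    ... | no none = done none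
    ... | yes (p , x , e) with explore e
    ...   | inj₁ er = ear er
    -- Forbidding the side just found makes a second side disjoint from it. If no exit remains, all
    -- exits lead into that side, which has a single edge.
    ...   | inj₂ (σ , refl) with exit? S (X ∪ Reach.F (Side.ρ σ))
    ...     | no none = bridge (e , only)
      where
      F = Reach.F (Side.ρ σ)
      ξ = Side.exit σ
      only : ∀ {u v} → Exit S X u v → u ≡ OneExit.outer ξ × v ≡ x
      only {u} {v} (u∈ , v∉ , v∉X , h) with bool-dichotomy (F v)
      ... | inj₂ v∉F = ⊥-elim (none (u , v , u∈ , v∉ , ∨-false⁺ v∉X v∉F , h))
      ... | inj₁ v∈F with OneExit.only ξ v∈F u∉F (trans (H-sym v u) h)
        where
        u∉F : F u ≡ false
        u∉F with bool-dichotomy (F u)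
        ... | inj₂ e′ = e′
        ... | inj₁ u∈F = ⊥-elim (true≢false u∈ (proj₁ (∨-false {S u} (reach-∉ (Side.ρ σ) (∨-false⁺ (proj₁ (proj₂ e)) (proj₁ (proj₂ (proj₂ e)))) u∈F))))
      ...   | a , b = b , trans a (Side.inner≡x σ)
    ...     | yes (p′ , x′ , p′∈ , x′∉ , x′∉XF , h′) with ∨-false {X x′} x′∉XF
    ...       | x′∉X , x′∉F with explore (p′∈ , x′∉ , x′∉X , h′)
    ...         | inj₁ er = ear er
    ...         | inj₂ (σ′ , refl) = fork σ σ′ (∨-false⁺ (proj₁ (proj₂ e)) (proj₁ (proj₂ (proj₂ e)))) (∨-false⁺ x′∉ x′∉X) p′∈ x′∉F

    ear-zone : (η : Ear) → Zone c → Zone (Ear.core η)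
    ear-zone η z = record
      { Z = Zone.Z z ; exit = Zone.exit z
      ; Z⊆ = λ {u} u∈ → widen u (∨-split {S u} (Zone.Z⊆ z u∈))
      ; t∉Z = subst (λ v → Zone.Z z v ≡ false) (sym (Ear.same-t η)) (Zone.t∉Z z) }
      where
      widen : ∀ u → S u ≡ true ⊎ X u ≡ true → (Core.S (Ear.core η) ∪ X) u ≡ true
      widen u (inj₁ e) = ∨-true₁ _ (Ear.S⊆ η e)
      widen u (inj₂ e) = ∨-true₂ (Core.S (Ear.core η) u) e

  ∅ : Sub n
  ∅ _ = false

  tripod : ∀ t (A B C : Sub n) → OneExit A → OneExit B → OneExit C → A t ≡ false → B t ≡ false → C t ≡ false →
           (∀ {u} → A u ≡ true → B u ≡ false) → (∀ {u} → A u ≡ true → C u ≡ false) → (∀ {u} → B u ≡ true → C u ≡ false) → Tripod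
  tripod t A B C eA eB eC tA tB tC AB AC BC = record
    { t = t ; F = F ; exit = λ { 0F → eA ; 1F → eB ; 2F → eC } ; disj = disj ; t∉ = λ { 0F → tA ; 1F → tB ; 2F → tC } }
    where
    F : Fin 3 → Sub n
    F 0F = A
    F 1F = B
    F 2F = C
    disj : ∀ {i j} → i ≢ j → ∀ u → F i u ≡ true → F j u ≡ false
    disj {0F} {0F} ne = ⊥-elim (ne refl)
    disj {0F} {1F} ne u = AB
    disj {0F} {2F} ne u = AC
    disj {1F} {0F} ne u = disjoint-sym {S = B} {A} AB
    disj {1F} {1F} ne = ⊥-elim (ne refl)
    disj {1F} {2F} ne u = BC
    disj {2F} {0F} ne u = disjoint-sym {S = C} {A} AC
    disj {2F} {1F} ne u = disjoint-sym {S = C} {B} BC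
    disj {2F} {2F} ne = ⊥-elim (ne refl)

  module _ {X : Sub n} (c : Core X) where
    open Core c

    side-∉ : ∀ {x} (σ : Side c x) → (S ∪ X) x ≡ false → ∀ {u} → (S ∪ X) u ≡ true → Reach.F (Side.ρ σ) u ≡ false
    side-∉ σ x∉ = disjoint-sym {S = S ∪ X} (reach-∉ (Side.ρ σ) x∉)

    sides-disjoint : ∀ {x x′} (σ : Side c x) (σ′ : Side c x′) → (S ∪ X) x′ ≡ false → Reach.F (Side.ρ σ) x′ ≡ false →
                     ∀ {u} → Reach.F (Side.ρ σ) u ≡ true → Reach.F (Side.ρ σ′) u ≡ false
    sides-disjoint σ σ′ x′∉ x′∉F {u} u∈F with bool-dichotomy (Reach.F (Side.ρ σ′) u)
    ... | inj₂ u∉F′ = u∉F′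
    ... | inj₁ u∈F′ = ⊥-elim (true≢false
            (reach-walk (Side.ρ σ) u∈F (outside-reverse x′∉ (Reach.walk (Side.ρ σ′) u∈F′))) x′∉F)

    -- While S is strongly connected, two bridges may leave it: one of their sides waits in X until the
    -- other has been oriented away from S, and is entered after the orientation has been reversed.
    set-aside : ∀ {x} → (∀ {u} → X u ≡ false) → t ≡ r → (σ : Side c x) → (S ∪ X) x ≡ false →
                S (OneExit.outer (Side.exit σ)) ≡ true → Σ (Core (Reach.F (Side.ρ σ))) Zone
    set-aside X≡∅ refl σ x∉ p∈ = core , record
      { Z = F ; exit = ξ ; Z⊆ = λ {u} u∈ → ∨-true₂ (S u) u∈ ; t∉Z = S∩F t∈S }
      where
      F = Reach.F (Side.ρ σ)
      ξ = Side.exit σ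
      S∩F : ∀ {u} → S u ≡ true → F u ≡ false
      S∩F u∈ = side-∉ σ x∉ (∨-true₁ _ u∈)
      sealed : ∀ {u v} → F v ≡ true → F u ≡ false → H u v ≡ true → S u ≡ true
      sealed {u} {v} v∈ u∉ h with OneExit.only ξ v∈ u∉ (trans (H-sym v u) h)
      ... | _ , refl = p∈
      core : Core F
      core = record
        { S = S ; D = D ; D? = D? ; D⇒H = D⇒H ; anti = anti ; supp = supp ; r = r ; t = t ; t∈S = t∈S
        ; from-r = from-r ; to-t = to-t ; comparable = comparable ; S∩X = S∩F
        ; exits = λ u∈ v∉ _ → exits u∈ v∉ X≡∅ ; X-exits = λ u∈ _ _ → to-t u∈ ; X-sealed = sealed }

  -- The zone turns every fork into a tripod: `Z` lies in `S ∪ X`, the two sides lie outside it, and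
  -- `t` is in none of the three. Ears keep the zone and bridges replace it.
  run-zone : ∀ {X} (c : Core X) → Zone c → Σ (Core X) Done ⊎ Tripod
  run-zone {X} c z = saturate (card ∘ Core.S ∘ proj₁) n (λ s → card≤n (Core.S (proj₁ s))) grow (c , z)
    where
    grow : ∀ (s : Σ (Core X) Zone) → (Σ (Core X) Done ⊎ Tripod) ⊎ (∃ λ (s′ : Σ (Core X) Zone) → card (Core.S (proj₁ s)) < card (Core.S (proj₁ s′)))
    grow (c , z) with next c
    ... | done d = inj₁ (inj₁ (c , d))
    ... | ear η = inj₂ ((Ear.core η , ear-zone c η z) , Ear.grows η)
    ... | bridge e = let c′ , z′ , lt = advance c e in inj₂ ((c′ , z′) , lt)
    ... | fork σ σ′ x∉ x′∉ _ x′∉F = inj₁ (inj₂ (tripod t Z _ _ exit (Side.exit σ) (Side.exit σ′)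
            t∉Z (side-∉ c σ x∉ (∨-true₁ _ t∈S)) (side-∉ c σ′ x′∉ (∨-true₁ _ t∈S))
            (λ u∈ → side-∉ c σ x∉ (Z⊆ u∈)) (λ u∈ → side-∉ c σ′ x′∉ (Z⊆ u∈)) (sides-disjoint c σ σ′ x′∉ x′∉F)))
      where
      open Core c
      open Zone z

  HConnected : Set
  HConnected = ∀ (S : Sub n) {x} → S x ≡ true → (∀ {u v} → S u ≡ true → H u v ≡ true → S v ≡ true) → ∀ u → S u ≡ true

  module _ (conn : HConnected) where

    done-full : ∀ {X} (c : Core X) → Done c → ∀ u → (Core.S c ∪ X) u ≡ true
    done-full {X} c d = conn (S ∪ X) {t} (∨-true₁ _ t∈S) λ {u} {v} u∈ h → closed u v (∨-split {S u} u∈) h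
      where
      open Core c
      closed : ∀ u v → S u ≡ true ⊎ X u ≡ true → H u v ≡ true → (S ∪ X) v ≡ true
      closed u v u∈ h with bool-dichotomy (S v) | bool-dichotomy (X v)
      ... | inj₁ v∈S | _ = ∨-true₁ _ v∈S
      ... | _ | inj₁ v∈X = ∨-true₂ (S v) v∈X
      closed u v (inj₁ u∈S) h | inj₂ v∉S | inj₂ v∉X = ⊥-elim (d (u , v , u∈S , v∉S , v∉X , h))
      closed u v (inj₂ u∈X) h | inj₂ v∉S | inj₂ v∉X = ⊥-elim (true≢false (X-sealed u∈X v∉X (trans (H-sym v u) h)) v∉S)

    finish : Σ (Core ∅) Done ⊎ Tripod → Unilateral ⊎ Tripod
    finish (inj₂ b) = inj₂ b
    finish (inj₁ (c , d)) = inj₁ record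
      { D = D ; D? = D? ; D⇒H = D⇒H ; anti = anti ; comparable = λ u v → comparable (full u) (full v) }
      where
      open Core c
      full : ∀ u → S u ≡ true
      full u with ∨-split {S u} (done-full c d u)
      ... | inj₁ e = e

    -- Reversing the orientation makes the exit into X the single exit of S.
    turn : ∀ {X} (c : Core X) → Done c → OneExit X → Σ (Core ∅) Zone
    turn {X} c d ξ = proj₁ adv , proj₁ (proj₂ adv)
      where
      open Core c
      open OneExit ξ
      p∈ : S outer ≡ true
      p∈ = X-sealed inner∈ outer∉ (trans (H-sym outer inner) edge)
      p⇝r : Star D outer r
      p⇝r = X-exits p∈ inner∈ (trans (H-sym outer inner) edge)
      X-rest : ∀ {v} → S v ≡ false → X v ≡ true
      X-rest {v} v∉ with ∨-split {S v} (done-full c d v)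
      ... | inj₁ v∈ = ⊥-elim (true≢false v∈ v∉)
      ... | inj₂ v∈ = v∈
      back : ∀ {u v} → Star D u v → Star (flip D) v u
      back = reverse (λ e → e)
      comp′ : ∀ {u v} → S u ≡ true → S v ≡ true → Star (flip D) u v ⊎ Star (flip D) v u
      comp′ u∈ v∈ with comparable u∈ v∈
      ... | inj₁ w = inj₂ (back w)
      ... | inj₂ w = inj₁ (back w)
      exits′ : ∀ {u v} → S u ≡ true → S v ≡ false → ∅ v ≡ false → H u v ≡ true → Star (flip D) outer u
      exits′ {u} {v} u∈ v∉ _ h with only (X-rest v∉) (S∩X u∈) (trans (H-sym v u) h)
      ... | _ , refl = ε
      core : Core ∅
      core = record
        { S = S ; D = flip D ; D? = flip D? ; D⇒H = λ {u} {v} e → trans (H-sym u v) (D⇒H e) ; anti = λ e e′ → anti e′ e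
        ; supp = λ e → proj₂ (supp e) , proj₁ (supp e) ; r = t ; t = outer ; t∈S = p∈
        ; from-r = λ u∈ → back (to-t u∈) ; to-t = λ u∈ → back (p⇝r ◅◅ from-r u∈) ; comparable = comp′
        ; S∩X = λ _ → refl ; exits = exits′ ; X-exits = λ _ () ; X-sealed = λ () }
      x∉S : S inner ≡ false
      x∉S = disjoint-sym {S = X} {S} S∩X inner∈
      single : SingleExit core outer inner
      single = (p∈ , x∉S , refl , trans (H-sym outer inner) edge) ,
        λ {u} {v} e → let a , b = only (X-rest (proj₁ (proj₂ e))) (S∩X (proj₁ e)) (trans (H-sym v u) (proj₂ (proj₂ (proj₂ e)))) in b , a
      adv = advance core single

    start-core : Fin n → Core ∅
    start-core x = record
      { S = ⁅ x ⁆ ; D = λ _ _ → ⊥ ; D? = λ _ _ → no λ () ; D⇒H = λ () ; anti = λ () ; supp = λ () ; r = x ; t = x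
      ; t∈S = ⁅⁆-self x ; from-r = to ; to-t = λ u∈ → from u∈
      ; comparable = λ u∈ v∈ → inj₁ (from u∈ ◅◅ to v∈)
      ; S∩X = λ _ → refl ; exits = λ u∈ _ _ _ → to u∈ ; X-exits = λ _ () ; X-sealed = λ () }
      where
      to : ∀ {u} → ⁅ x ⁆ u ≡ true → Star (λ _ _ → ⊥) x u
      to u∈ with ⁅⁆-true u∈
      ... | refl = ε
      from : ∀ {u} → ⁅ x ⁆ u ≡ true → Star (λ _ _ → ⊥) u x
      from u∈ with ⁅⁆-true u∈
      ... | refl = ε

    -- The invariant `t ≡ r` says that `S` is strongly connected; ears preserve it. The first bridge
    -- or fork ends this phase and provides a zone: what lies behind the bridge, or the side set
    -- aside. From then on only one direction of growth is left, and `resume` uses the other end of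
    -- the orientation for the side that waited.
    unilateral-or-tripod : Fin n → Unilateral ⊎ Tripod
    unilateral-or-tripod x =
      saturate (card ∘ Core.S ∘ proj₁) n (λ s → card≤n (Core.S (proj₁ s))) grow (start-core x , refl)
      where
      State : Set₁
      State = Σ (Core ∅) λ c → Core.t c ≡ Core.r c
      resume : ∀ {X} → Σ (Core X) Done ⊎ Tripod → OneExit X → Unilateral ⊎ Tripod
      resume (inj₂ b) ξ = inj₂ b
      resume (inj₁ (c , d)) ξ = let c′ , z = turn c d ξ in finish (run-zone c′ z)
      grow : ∀ (s : State) → (Unilateral ⊎ Tripod) ⊎ (∃ λ (s′ : State) → card (Core.S (proj₁ s)) < card (Core.S (proj₁ s′)))
      grow (c , t≡r) with next c
      ... | done d = inj₁ (finish (inj₁ (c , d)))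
      ... | ear η = inj₂ ((Ear.core η , trans (Ear.same-t η) (trans t≡r (sym (Ear.same-r η)))) , Ear.grows η)
      ... | bridge e = let c′ , z , _ = advance c e in inj₁ (finish (run-zone c′ z))
      ... | fork σ σ′ _ x′∉ p′∈ _ = let c′ , z = set-aside c refl t≡r σ′ x′∉ p′∈ in inj₁ (resume (run-zone c′ z) (Side.exit σ′))

-- From unilateral orientations to colourings

module _ {n k : ℕ} {G : Graph n} (c : EdgeColoring G k) {R : Fin n → Fin n → Set}
         (R⇒adj : ∀ {u v} → R u v → Adj G u v)
         (alternates : ∀ {u v w} → R u v → R v w → col c u v ≢ col c v w) where

  path-proper : ∀ {u v l} → Path R u v l → ProperPath c u v l
  path-proper p = (walk p , unique p , first p , final p) , proper p
    where
    walk : ∀ {u v l} → Path R u v l → Walk G l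
    walk stop = tt
    walk (step r _ stop) = R⇒adj r , tt
    walk (step r _ p@(step _ _ _)) = R⇒adj r , walk p
    unique : ∀ {u v l} → Path R u v l → Unique l
    unique stop = [] ∷ []
    unique (step _ u∉ p) = ¬Any⇒All¬ _ u∉ ∷ unique p
    first : ∀ {u v l} → Path R u v l → head l ≡ just u
    first stop = refl
    first (step _ _ _) = refl
    final : ∀ {u v l} → Path R u v l → last l ≡ just v
    final stop = refl
    final (step _ _ stop) = refl
    final (step _ _ p@(step _ _ _)) = final p
    proper : ∀ {u v l} → Path R u v l → ProperSeq c l
    proper stop = tt
    proper (step _ _ stop) = tt
    proper (step r _ (step r′ _ stop)) = alternates r r′ , tt
    proper (step r _ p@(step r′ _ (step _ _ _))) = alternates r r′ , proper p

module Cut {n : ℕ} (G : Graph n) (f : Sub n) where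

  cutEdge : Fin n → Fin n → Bool
  cutEdge u v = adj G u v ∧ (f u xor f v)

  cutEdge-sym : ∀ u v → cutEdge u v ≡ cutEdge v u
  cutEdge-sym u v = cong₂ _∧_ (adj-sym G u v) (xor-comm (f u) (f v))

  open Orientation cutEdge cutEdge-sym public

bit : Bool → Fin 2
bit false = 0F
bit true  = 1F

bit-≢ : ∀ a b → a xor b ≡ true → bit a ≢ bit b
bit-≢ true  true  ()
bit-≢ true  false _ ()
bit-≢ false true  _ ()
bit-≢ false false ()

module _ {n : ℕ} (G : Graph n) (f : Sub n) where
  open Cut G f

  unilateral⇒pc : Unilateral → ProperlyConnectedWith G 2
  unilateral⇒pc U = c , λ u v _ → connect u v
    where
    open Unilateral U
    tailSide : Fin n → Fin n → Bool
    -- By `anti` at most one disjunct can survive, and for an oriented edge it is the side of its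
    -- tail; edges without a direction get `false`.
    tailSide u v = (f u ∧ ⌊ D? u v ⌋) ∨ (f v ∧ ⌊ D? v u ⌋)
    c : EdgeColoring G 2
    c = record { col = λ u v → bit (tailSide u v) ; col-sym = λ u v → cong bit (∨-comm (f u ∧ ⌊ D? u v ⌋) _) }
    tail-side : ∀ {u v} → D u v → tailSide u v ≡ f u
    tail-side {u} {v} d with D? u v | D? v u
    ... | no ¬d | _      = ⊥-elim (¬d d)
    ... | yes _ | yes d′ = ⊥-elim (anti d d′)
    ... | yes _ | no _   with f u | f v
    ...   | true  | _     = refl
    ...   | false | true  = refl
    ...   | false | false = refl
    crosses : ∀ {u v} → D u v → f u xor f v ≡ true
    crosses {u} {v} d = proj₂ (∧-true {adj G u v} (D⇒H d))
    adjacent : ∀ {u v} → D u v → Adj G u v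
    adjacent {u} {v} d = proj₁ (∧-true {adj G u v} (D⇒H d))
    forward : ∀ {u v w} → D u v → D v w → col c u v ≢ col c v w
    forward {u} {v} d e rewrite tail-side d | tail-side e = bit-≢ (f u) (f v) (crosses d)
    backward : ∀ {u v w} → D v u → D w v → col c u v ≢ col c v w
    backward {u} {v} {w} d e eq = forward e d (sym (trans (col-sym c v u) (trans eq (col-sym c v w))))
    connect : ∀ u v → ∃ λ p → ProperPath c u v p
    connect u v with comparable u v
    ... | inj₁ w = let l , p = simple-path w in
                   l , path-proper c adjacent forward p
    ... | inj₂ w = let l , p = simple-path (reverse {U = flip D} (λ e → e) w) in
                   l , path-proper c {R = flip D} (λ {a} {b} d → trans (adj-sym G a b) (adjacent d)) backward p

-- One colour is not enough

module _ {n : ℕ} (G : Graph n) where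

  -- With one colour a proper path has at most one edge, which would make `G` complete. With no
  -- colours `col` has no value to take at a vertex pair.
  pc≥2 : 2 ≤ n → ¬ Complete G → ∀ j → ProperlyConnectedWith G j → 2 ≤ j
  pc≥2 (s≤s (s≤s _)) nc 0 (c , _) with col c 0F 0F
  ... | ()
  pc≥2 _ nc 1 (c , pp) = ⊥-elim (nc λ u v u≢v → direct u v u≢v (pp u v u≢v))
    where
    all-equal : ∀ (a b : Fin 1) → a ≡ b
    all-equal 0F 0F = refl
    direct : ∀ u v → u ≢ v → (∃ λ p → ProperPath c u v p) → Adj G u v
    direct u v u≢v ([] , (_ , _ , () , _) , _)
    direct u v u≢v (a ∷ [] , (_ , _ , refl , refl) , _) = ⊥-elim (u≢v refl)
    direct u v u≢v (a ∷ b ∷ [] , ((e , _) , _ , refl , refl) , _) = e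
    direct u v u≢v (a ∷ b ∷ d ∷ l , _ , ne , _) = ⊥-elim (ne (all-equal _ _))
  pc≥2 _ nc (suc (suc j)) _ = s≤s (s≤s z≤n)

-- Double sums and witnesses from cardinalities

sum₂-+ : ∀ {n} (f g : Fin n → Fin n → ℕ) →
         (sum λ u → sum λ w → f u w + g u w) ≡ (sum λ u → sum (f u)) + (sum λ u → sum (g u))
sum₂-+ f g = trans (sum-cong-≗ λ u → ∑-distrib-+ (f u) (g u)) (∑-distrib-+ (λ u → sum (f u)) (λ u → sum (g u)))

sum₂-mono : ∀ {n} {f g : Fin n → Fin n → ℕ} → (∀ u w → f u w ≤ g u w) → (sum λ u → sum (f u)) ≤ (sum λ u → sum (g u))
sum₂-mono f≤g = sum-mono-≤ λ u → sum-mono-≤ (f≤g u)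

sum₂-cong : ∀ {n} {f g : Fin n → Fin n → ℕ} → (∀ u w → f u w ≡ g u w) → (sum λ u → sum (f u)) ≡ (sum λ u → sum (g u))
sum₂-cong f≡g = sum-cong-≗ λ u → sum-cong-≗ (f≡g u)

sum₂-indicator : ∀ {n} (x p : Fin n) → (sum λ u → sum λ w → ⟦ ⁅ x ⁆ u ∧ ⁅ p ⁆ w ⟧) ≡ 1
sum₂-indicator x p = trans (sum-single x λ u u≢x → sum-zero λ w → cong (λ b → ⟦ b ∧ ⁅ p ⁆ w ⟧) (⁅⁆-false u≢x))
  (trans (sum-single p λ w w≢p → cong ⟦_⟧ (trans (cong (⁅ x ⁆ x ∧_) (⁅⁆-false w≢p)) (∧-zeroʳ (⁅ x ⁆ x))))
         (cong ⟦_⟧ (∧-true⁺ (⁅⁆-self x) (⁅⁆-self p))))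

find-one : ∀ {n} (p : Sub n) → 1 ≤ card p → ∃ λ u → p u ≡ true
find-one {zero}  p ()
find-one {suc n} p le with p zero in eq
... | true  = zero , eq
... | false = let u , e = find-one (p ∘ suc) le in suc u , e

find-two : ∀ {n} (p : Sub n) → 2 ≤ card p → ∃₂ λ u v → u ≢ v × p u ≡ true × p v ≡ true
find-two {zero}  p ()
find-two {suc n} p le with p zero in eq
... | true  = let v , e = find-one (p ∘ suc) (≤-pred le) in zero , suc v , (λ ()) , eq , e
... | false = let u , v , u≢v , e , e′ = find-two (p ∘ suc) le in suc u , suc v , u≢v ∘ suc-injective , e , e′

nonempty? : ∀ {n} (S : Sub n) → (∃ λ u → S u ≡ true) ⊎ (∀ u → S u ≡ false)
nonempty? S with any? (λ u → S u ≟ᵇ true)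
... | yes e = inj₁ e
... | no none = inj₂ λ u → empty u (bool-dichotomy (S u))
  where
  empty : ∀ u → S u ≡ true ⊎ S u ≡ false → S u ≡ false
  empty u (inj₁ e) = ⊥-elim (none (u , e))
  empty u (inj₂ e) = e

-- Edge boundaries and maximum cuts

module Boundary {n : ℕ} (G : Graph n) where

  nb : Sub n → Fin n → ℕ
  nb B u = card λ w → B w ∧ adj G u w

  -- Boundary edges are recorded from their inner end only, so `∂` counts each of them once.
  ∂ₑ : Sub n → Fin n → Fin n → Bool
  ∂ₑ S u w = S u ∧ (not (S w) ∧ adj G u w)

  ∂ᵥ : Sub n → Fin n → ℕ
  ∂ᵥ S u = card (∂ₑ S u)

  ∂ : Sub n → ℕ
  ∂ S = sum (∂ᵥ S)

  ∂ᵥ-∈ : ∀ (S : Sub n) {u} → S u ≡ true → ∂ᵥ S u ≡ nb (∁ S) u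
  ∂ᵥ-∈ S u∈ = sum-cong-≗ λ w → cong (λ b → ⟦ b ∧ (not (S w) ∧ adj G _ w) ⟧) u∈

  ∂-∁ : ∀ S → ∂ (∁ S) ≡ ∂ S
  ∂-∁ S = trans (∑-comm (λ u w → ⟦ ∂ₑ (∁ S) u w ⟧))
                (sum₂-cong λ w u → cong ⟦_⟧ (trans (eq (S w) (S u) (adj G u w)) (cong (λ b → S w ∧ (not (S u) ∧ b)) (adj-sym G u w))))
    where
    eq : ∀ a b e → not b ∧ (not (not a) ∧ e) ≡ a ∧ (not b ∧ e)
    eq true  true  e = refl
    eq true  false e = refl
    eq false true  e = refl
    eq false false e = refl

  ∂-∪ : ∀ S T → ∂ (S ∪ T) ≤ ∂ S + ∂ T
  ∂-∪ S T = ≤-trans (sum₂-mono λ u w → le (S u) (T u) (S w) (T w) (adj G u w)) (≤-reflexive (sum₂-+ (λ u w → ⟦ ∂ₑ S u w ⟧) (λ u w → ⟦ ∂ₑ T u w ⟧)))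
    where
    le : ∀ a b c d e → ⟦ (a ∨ b) ∧ (not (c ∨ d) ∧ e) ⟧ ≤ ⟦ a ∧ (not c ∧ e) ⟧ + ⟦ b ∧ (not d ∧ e) ⟧
    le a     b     c     d     false rewrite ∧-zeroʳ (not (c ∨ d)) | ∧-zeroʳ (a ∨ b) = z≤n
    le false b     true  d     true rewrite ∧-zeroʳ b = z≤n
    le false b     false d     true = ≤-refl
    le true  b     true  d     true = z≤n
    le true  b     false true  true = z≤n
    le true  b     false false true = s≤s z≤n

  ∂-∩ : ∀ S T → ∂ (S ∩ T) ≤ ∂ S + ∂ T
  ∂-∩ S T = ≤-trans (sum₂-mono λ u w → le (S u) (T u) (S w) (T w) (adj G u w)) (≤-reflexive (sum₂-+ (λ u w → ⟦ ∂ₑ S u w ⟧) (λ u w → ⟦ ∂ₑ T u w ⟧)))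
    where
    le : ∀ a b c d e → ⟦ (a ∧ b) ∧ (not (c ∧ d) ∧ e) ⟧ ≤ ⟦ a ∧ (not c ∧ e) ⟧ + ⟦ b ∧ (not d ∧ e) ⟧
    le a     b     c     d     false rewrite ∧-zeroʳ (not (c ∧ d)) | ∧-zeroʳ (a ∧ b) = z≤n
    le false b     c     d     true = z≤n
    le true  false c     d     true = z≤n
    le true  true  false d     true = s≤s z≤n
    le true  true  true  d     true = ≤-refl

  degree-split : ∀ S u → degree G u ≡ nb S u + nb (∁ S) u
  degree-split S u = trans (degree-sum G u) (trans (sum-cong-≗ λ w → eq (S w) (adj G u w))
    (∑-distrib-+ (λ w → ⟦ S w ∧ adj G u w ⟧) (λ w → ⟦ not (S w) ∧ adj G u w ⟧)))
    where
    eq : ∀ a e → ⟦ e ⟧ ≡ ⟦ a ∧ e ⟧ + ⟦ not a ∧ e ⟧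
    eq true  true  = refl
    eq true  false = refl
    eq false e     = refl

  nb<card : ∀ (S : Sub n) {u} → S u ≡ true → nb S u < card S
  nb<card S {u} u∈ = card-mono-< (λ w e → proj₁ (∧-true {S w} e)) u
    (trans (cong (S u ∧_) (adj-irr G u)) (∧-zeroʳ (S u))) u∈

  nb-∁≤∂ : ∀ (S : Sub n) {u} → S u ≡ true → nb (∁ S) u ≤ ∂ S
  nb-∁≤∂ S {u} u∈ = subst (_≤ ∂ S) (∂ᵥ-∈ S u∈) (term≤sum (∂ᵥ S) u)

  nb≤∂ : ∀ (S : Sub n) {u} → S u ≡ false → nb S u ≤ ∂ S
  nb≤∂ S {u} u∉ = begin
    nb S u         ≤⟨ card-mono (λ w e → subst (λ b → b ∧ adj G u w ≡ true) (sym (not-not (S w))) e) ⟩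
    nb (∁ (∁ S)) u ≤⟨ nb-∁≤∂ (∁ S) (not-false u∉) ⟩
    ∂ (∁ S)        ≡⟨ ∂-∁ S ⟩
    ∂ S            ∎
    where
    open ≤-Reasoning
    not-not : ∀ b → not (not b) ≡ b
    not-not true  = refl
    not-not false = refl

  nb-mono : ∀ {S T : Sub n} → (∀ u → S u ≡ true → T u ≡ true) → ∀ u → nb S u ≤ nb T u
  nb-mono {S} S⊆T u = card-mono λ w e → let w∈ , a = ∧-true {S w} e in ∧-true⁺ (S⊆T w w∈) a

  nb-empty : ∀ {S : Sub n} → (∀ u → S u ≡ false) → ∀ u → nb S u ≡ 0
  nb-empty S≡∅ u = sum-zero λ w → cong (λ b → ⟦ b ∧ adj G u w ⟧) (S≡∅ w)

  ∂≡0⇒closed : ∀ S → ∂ S ≡ 0 → ∀ {u v} → S u ≡ true → adj G u v ≡ true → S v ≡ true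
  ∂≡0⇒closed S e {u} {v} u∈ a with bool-dichotomy (S v)
  ... | inj₁ v∈ = v∈
  ... | inj₂ v∉ with trans (sym (sum≡0⇒ (λ w → ⟦ ∂ₑ S u w ⟧) (sum≡0⇒ (∂ᵥ S) e u) v))
                           (cong ⟦_⟧ (∧-true⁺ u∈ (∧-true⁺ (not-false v∉) a)))
  ...   | ()

  module MinDegree {δ : ℕ} (δ≤deg : ∀ v → δ ≤ degree G v) where

    -- A vertex of `S` has at most `card S - 1` neighbours in `S`; summing over `S` leaves the
    -- remaining degree to the boundary.
    degree-count : ∀ S → card S * suc δ ≤ card S * card S + ∂ S
    degree-count S = begin
      card S * suc δ                                      ≡⟨ *-distribʳ-sum (suc δ) (λ u → ⟦ S u ⟧) ⟩
      (sum λ u → ⟦ S u ⟧ * suc δ)                         ≤⟨ sum-mono-≤ (λ u → row u (bool-dichotomy (S u))) ⟩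
      (sum λ u → ⟦ S u ⟧ * card S + ∂ᵥ S u)               ≡⟨ ∑-distrib-+ (λ u → ⟦ S u ⟧ * card S) (∂ᵥ S) ⟩
      (sum λ u → ⟦ S u ⟧ * card S) + ∂ S                  ≡⟨ cong (_+ ∂ S) (sym (*-distribʳ-sum (card S) (λ u → ⟦ S u ⟧))) ⟩
      card S * card S + ∂ S                               ∎
      where
      open ≤-Reasoning
      row : ∀ u → S u ≡ true ⊎ S u ≡ false → ⟦ S u ⟧ * suc δ ≤ ⟦ S u ⟧ * card S + ∂ᵥ S u
      row u (inj₂ u∉) = subst (λ b → ⟦ b ⟧ * suc δ ≤ ⟦ b ⟧ * card S + ∂ᵥ S u) (sym u∉) z≤n
      row u (inj₁ u∈) = subst (λ b → ⟦ b ⟧ * suc δ ≤ ⟦ b ⟧ * card S + ∂ᵥ S u) (sym u∈) (begin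
        1 * suc δ                  ≡⟨ *-identityˡ (suc δ) ⟩
        suc δ                      ≤⟨ s≤s (δ≤deg u) ⟩
        suc (degree G u)           ≡⟨ cong suc (degree-split S u) ⟩
        suc (nb S u) + nb (∁ S) u  ≤⟨ +-mono-≤ (nb<card S u∈) (≤-reflexive (sym (∂ᵥ-∈ S u∈))) ⟩
        card S + ∂ᵥ S u            ≡⟨ cong (_+ ∂ᵥ S u) (sym (*-identityˡ (card S))) ⟩
        1 * card S + ∂ᵥ S u        ∎)

    -- If `k = card S ≤ δ`, then `degree-count` gives `∂ S ≥ k * (δ + 1 - k)`, and this product is
    -- at least `δ` for `1 ≤ k ≤ δ`.
    small-boundary⇒large : ∀ S {x} → S x ≡ true → ∂ S < δ → δ < card S
    small-boundary⇒large S x∈ ∂<δ with suc δ ≤? card S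
    ... | yes lt = lt
    ... | no ¬lt with m≤n⇒∃[o]m+o≡n (≤-pred (≰⇒> ¬lt))
    ...   | j , refl = ⊥-elim (<-irrefl refl (≤-<-trans k+j≤∂ ∂<δ))
      where
      k = card S
      open ≤-Reasoning
      k+j≤∂ : k + j ≤ ∂ S
      k+j≤∂ = +-cancelˡ-≤ (k * k) _ _ (begin
        k * k + (k + j)     ≤⟨ +-monoʳ-≤ (k * k) (+-monoʳ-≤ k (subst (_≤ k * j) (*-identityˡ j) (*-monoˡ-≤ j (card>0 {S = S} x∈)))) ⟩
        k * k + (k + k * j) ≡⟨ ring k j ⟩
        k * suc (k + j)     ≤⟨ degree-count S ⟩
        k * k + ∂ S         ∎)
        where
        ring : ∀ k j → k * k + (k + k * j) ≡ k * suc (k + j)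
        ring = solve-∀

module MaxCut {n : ℕ} (G : Graph n) where
  open Boundary G

  -- The sum runs over ordered pairs, so each cut edge counts twice.
  cutSize : Sub n → ℕ
  cutSize f = sum λ u → card (Cut.cutEdge G f u)

  _⊕_ : Sub n → Sub n → Sub n
  (f ⊕ S) u = f u xor S u

  cutSize-cong : ∀ {f g} → f ≗ g → cutSize f ≡ cutSize g
  cutSize-cong f≗g = sum₂-cong λ u w → cong₂ (λ a b → ⟦ adj G u w ∧ (a xor b) ⟧) (f≗g u) (f≗g w)

  -- The search for a better cut ranges over vectors; `K-resp` carries the constraint from a
  -- function to its tabulation without function extensionality.
  max-cut : ∀ (K : Sub n → Set) → (∀ f → Dec (K f)) → (∀ {f g} → f ≗ g → K f → K g) → ∃ K →
            Σ (Sub n) λ f → K f × (∀ g → K g → cutSize g ≤ cutSize f)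
  max-cut K K? K-resp = saturate (cutSize ∘ proj₁) (sum {n} λ _ → n) (λ s → sum-mono-≤ {g = λ _ → n} λ u → card≤n (Cut.cutEdge G (proj₁ s) u)) improve
    where
    improve : ∀ (s : ∃ K) → (Σ (Sub n) λ f → K f × (∀ g → K g → cutSize g ≤ cutSize f)) ⊎ (∃ λ (s′ : ∃ K) → cutSize (proj₁ s) < cutSize (proj₁ s′))
    improve (f , k) with anySubset? (λ s → K? (lookup s) ×-dec (cutSize f <? cutSize (lookup s)))
    ... | yes (s , ks , lt) = inj₂ ((lookup s , ks) , lt)
    ... | no none = inj₁ (f , k , λ g kg → ≮⇒≥ λ lt → none (tabulate g , K-resp (λ u → sym (lookup∘tabulate g u)) kg ,
            subst (cutSize f <_) (cutSize-cong λ u → sym (lookup∘tabulate g u)) lt))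

  module _ (f S : Sub n) where
    open Cut G f

    cross : Fin n → Fin n → Bool
    cross u w = cutEdge u w ∧ (S u xor S w)

    crossing : ℕ
    crossing = sum λ u → card (cross u)

    -- Boundary edges of `S` that were cut are lost and the others gained, written without
    -- subtraction. `crossing` counts ordered pairs and `∂` does not, which gives the two copies of
    -- each. The identity already holds for each pair `u`, `w`, once `∂ S` is paired with `∂ (∁ S)`.
    flip-count : cutSize (f ⊕ S) + (crossing + crossing) ≡ cutSize f + (∂ S + ∂ S)
    flip-count = begin
      cutSize (f ⊕ S) + (crossing + crossing)
        ≡⟨ cong (cutSize (f ⊕ S) +_) (sym (sum₂-+ h h)) ⟩
      cutSize (f ⊕ S) + (sum λ u → sum λ w → h u w + h u w)
        ≡⟨ sym (sum₂-+ (λ u w → ⟦ Cut.cutEdge G (f ⊕ S) u w ⟧) (λ u w → h u w + h u w)) ⟩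
      (sum λ u → sum λ w → ⟦ Cut.cutEdge G (f ⊕ S) u w ⟧ + (h u w + h u w))
        ≡⟨ sum₂-cong (λ u w → eq (adj G u w) (f u) (f w) (S u) (S w)) ⟩
      (sum λ u → sum λ w → ⟦ cutEdge u w ⟧ + (⟦ ∂ₑ S u w ⟧ + ⟦ ∂ₑ (∁ S) u w ⟧))
        ≡⟨ sum₂-+ (λ u w → ⟦ cutEdge u w ⟧) (λ u w → b u w + b′ u w) ⟩
      cutSize f + (sum λ u → sum λ w → ⟦ ∂ₑ S u w ⟧ + ⟦ ∂ₑ (∁ S) u w ⟧)
        ≡⟨ cong (cutSize f +_) (trans (sum₂-+ b b′) (cong (∂ S +_) (∂-∁ S))) ⟩
      cutSize f + (∂ S + ∂ S) ∎
      where
      open ≡-Reasoning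
      h : Fin n → Fin n → ℕ
      h u w = ⟦ cross u w ⟧
      b b′ : Fin n → Fin n → ℕ
      b  u w = ⟦ ∂ₑ S u w ⟧
      b′ u w = ⟦ ∂ₑ (∁ S) u w ⟧
      eq : ∀ e a b c d → ⟦ e ∧ ((a xor c) xor (b xor d)) ⟧ + (⟦ (e ∧ (a xor b)) ∧ (c xor d) ⟧ + ⟦ (e ∧ (a xor b)) ∧ (c xor d) ⟧)
                       ≡ ⟦ e ∧ (a xor b) ⟧ + (⟦ c ∧ (not d ∧ e) ⟧ + ⟦ not c ∧ (not (not d) ∧ e) ⟧)
      eq false false false false false = refl
      eq false false false false true = refl
      eq false false false true false = refl
      eq false false false true true = refl
      eq false false true false false = refl
      eq false false true false true = refl
      eq false false true true false = refl
      eq false false true true true = refl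
      eq false true false false false = refl
      eq false true false false true = refl
      eq false true false true false = refl
      eq false true false true true = refl
      eq false true true false false = refl
      eq false true true false true = refl
      eq false true true true false = refl
      eq false true true true true = refl
      eq true false false false false = refl
      eq true false false false true = refl
      eq true false false true false = refl
      eq true false false true true = refl
      eq true false true false false = refl
      eq true false true false true = refl
      eq true false true true false = refl
      eq true false true true true = refl
      eq true true false false false = refl
      eq true true false false true = refl
      eq true true false true false = refl
      eq true true false true true = refl
      eq true true true false false = refl
      eq true true true false true = refl
      eq true true true true false = refl
      eq true true true true true = refl

    ∂≤crossing : cutSize (f ⊕ S) ≤ cutSize f → ∂ S ≤ crossing
    ∂≤crossing le = half (+-cancelˡ-≤ (cutSize f) _ _ (subst (_≤ cutSize f + (crossing + crossing)) flip-count (+-monoˡ-≤ (crossing + crossing) le)))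
      where
      half : ∀ {a b} → a + a ≤ b + b → a ≤ b
      half {a} {b} le with a ≤? b
      ... | yes p = p
      ... | no ¬p = ⊥-elim (<-irrefl refl (<-≤-trans (+-mono-< (≰⇒> ¬p) (≰⇒> ¬p)) le))

    crossing-closed : (∀ {u v} → S u ≡ true → cutEdge u v ≡ true → S v ≡ true) → crossing ≡ 0
    crossing-closed closed = sum-zero λ u → sum-zero λ w → zero-term u w (bool-dichotomy (cross u w))
      where
      zero-term : ∀ u w → cross u w ≡ true ⊎ cross u w ≡ false → ⟦ cross u w ⟧ ≡ 0
      zero-term u w (inj₂ e) = cong ⟦_⟧ e
      zero-term u w (inj₁ e) with ∧-true {cutEdge u w} e
      ... | c , x with S u in eu | S w in ew
      ...   | true  | false = ⊥-elim (true≢false (closed eu c) ew)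
      ...   | false | true  = ⊥-elim (true≢false (closed ew (trans (cutEdge-sym w u) c)) eu)

    -- The bound is one edge counted in its two orders.
    crossing-OneExit : OneExit S → crossing ≤ 2
    crossing-OneExit ξ = begin
      crossing                                                               ≤⟨ sum₂-mono (λ u w → bound u w (bool-dichotomy (cross u w))) ⟩
      (sum λ u → sum λ w → ⟦ ⁅ x ⁆ u ∧ ⁅ p ⁆ w ⟧ + ⟦ ⁅ p ⁆ u ∧ ⁅ x ⁆ w ⟧)    ≡⟨ sum₂-+ (λ u w → ⟦ ⁅ x ⁆ u ∧ ⁅ p ⁆ w ⟧) (λ u w → ⟦ ⁅ p ⁆ u ∧ ⁅ x ⁆ w ⟧) ⟩
      _                                                                      ≡⟨ cong₂ _+_ (sum₂-indicator x p) (sum₂-indicator p x) ⟩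
      2                                                                      ∎
      where
      open ≤-Reasoning
      open OneExit ξ renaming (inner to x; outer to p)
      bound : ∀ u w → cross u w ≡ true ⊎ cross u w ≡ false → ⟦ cross u w ⟧ ≤ ⟦ ⁅ x ⁆ u ∧ ⁅ p ⁆ w ⟧ + ⟦ ⁅ p ⁆ u ∧ ⁅ x ⁆ w ⟧
      bound u w (inj₂ e) = subst (λ b → ⟦ b ⟧ ≤ ⟦ ⁅ x ⁆ u ∧ ⁅ p ⁆ w ⟧ + ⟦ ⁅ p ⁆ u ∧ ⁅ x ⁆ w ⟧) (sym e) z≤n
      bound u w (inj₁ e) with ∧-true {cutEdge u w} e
      ... | c , xr with S u in eu | S w in ew
      bound u w (inj₁ e) | c , xr | true | false with only eu ew c
      ... | refl , refl rewrite ∧-true⁺ (⁅⁆-self u) (⁅⁆-self w) = ≤-trans (⟦⟧≤1 _) (m≤m+n 1 _)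
      bound u w (inj₁ e) | c , xr | false | true with only ew eu (trans (cutEdge-sym w u) c)
      ... | refl , refl rewrite ∧-true⁺ (⁅⁆-self u) (⁅⁆-self w) = ≤-trans (⟦⟧≤1 _) (m≤n+m 1 _)

sum₃-≤ : ∀ {n} {f g h k : Fin n → ℕ} → (∀ w → f w ≤ g w + (h w + k w)) → sum f ≤ sum g + (sum h + sum k)
sum₃-≤ {g = g} {h} {k} le = ≤-trans (sum-mono-≤ le)
  (≤-reflexive (trans (∑-distrib-+ g (λ w → h w + k w)) (cong (sum g +_) (∑-distrib-+ h k))))

-- Here `δ + 1 - m ≥ 4`, so the second inequality yields `4 * m ≤ 6`.
m*-bound : ∀ m δ → m + 3 ≤ δ → m * suc δ ≤ m * m + 6 → m ≤ 1
m*-bound m δ le h with m≤n⇒∃[o]m+o≡n le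
... | j , refl = small m (+-cancelˡ-≤ (m * m) _ _ (begin
  m * m + m * 4           ≤⟨ +-monoʳ-≤ (m * m) (*-monoʳ-≤ m (m≤m+n 4 j)) ⟩
  m * m + m * (4 + j)     ≡⟨ ring m j ⟩
  m * suc (m + 3 + j)     ≤⟨ h ⟩
  m * m + 6               ∎))
  where
  open ≤-Reasoning
  ring : ∀ m j → m * m + m * (4 + j) ≡ m * suc (m + 3 + j)
  ring = solve-∀
  small : ∀ m → m * 4 ≤ 6 → m ≤ 1
  small 0 _ = z≤n
  small 1 _ = ≤-refl
  small (suc (suc m)) (s≤s (s≤s (s≤s (s≤s (s≤s (s≤s ()))))))

some≥2 : ∀ a b c → 4 ≤ a + (b + c) → 2 ≤ a ⊎ (2 ≤ b ⊎ 2 ≤ c)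
some≥2 (suc (suc a)) b c h = inj₁ (s≤s (s≤s z≤n))
some≥2 a (suc (suc b)) c h = inj₂ (inj₁ (s≤s (s≤s z≤n)))
some≥2 a b (suc (suc c)) h = inj₂ (inj₂ (s≤s (s≤s z≤n)))
some≥2 0 0 0 ()
some≥2 0 0 1 (s≤s ())
some≥2 0 1 0 (s≤s ())
some≥2 0 1 1 (s≤s (s≤s ()))
some≥2 1 0 0 (s≤s ())
some≥2 1 0 1 (s≤s (s≤s ()))
some≥2 1 1 0 (s≤s (s≤s ()))
some≥2 1 1 1 (s≤s (s≤s (s≤s ())))

-- Three large sets with small boundaries

module Spiders {n δ : ℕ} (G : Graph n) (δ≤deg : ∀ v → δ ≤ degree G v) (n≤4δ : n ≤ 4 * δ) (3≤δ : 3 ≤ δ) where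
  open Boundary G
  open MinDegree {δ} δ≤deg

  -- What a tripod leaves behind in `G` once the cut is forgotten. Since no cut is mentioned,
  -- spiders that come from two different cuts can be compared.
  record Spider (t : Fin n) (A B C : Sub n) : Set where
    field
      A∩B : ∀ {u} → A u ≡ true → B u ≡ false
      A∩C : ∀ {u} → A u ≡ true → C u ≡ false
      B∩C : ∀ {u} → B u ≡ true → C u ≡ false
      t∉A : A t ≡ false
      t∉B : B t ≡ false
      t∉C : C t ≡ false
      A≢∅ : ∃ λ u → A u ≡ true
      B≢∅ : ∃ λ u → B u ≡ true
      C≢∅ : ∃ λ u → C u ≡ true
      ∂A≤2 : ∂ A ≤ 2
      ∂B≤2 : ∂ B ≤ 2
      ∂C≤2 : ∂ C ≤ 2

  rotate : ∀ {t A B C} → Spider t A B C → Spider t B C A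
  rotate {A = A} {B} {C} s = record
    { A∩B = B∩C ; A∩C = disjoint-sym {S = B} {A} A∩B ; B∩C = disjoint-sym {S = C} {A} A∩C
    ; t∉A = t∉B ; t∉B = t∉C ; t∉C = t∉A ; A≢∅ = B≢∅ ; B≢∅ = C≢∅ ; C≢∅ = A≢∅ ; ∂A≤2 = ∂B≤2 ; ∂B≤2 = ∂C≤2 ; ∂C≤2 = ∂A≤2 }
    where open Spider s

  large : ∀ {t A B C} → Spider t A B C → δ < card A
  large {A = A} s = small-boundary⇒large A (proj₂ (Spider.A≢∅ s)) (<-≤-trans (s≤s (Spider.∂A≤2 s)) 3≤δ)

  module _ {t A B C} (s : Spider t A B C) where
    open Spider s

    body : Sub n
    body = ∁ (A ∪ (B ∪ C))

    t∈body : body t ≡ true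
    t∈body = not-false (∨-false⁺ t∉A (∨-false⁺ t∉B t∉C))

    total : card body + (card A + (card B + card C)) ≤ 4 * δ
    total = begin
      card body + (card A + (card B + card C))  ≡⟨ cong (λ k → card body + (card A + k)) (sym (card-disjoint-∪ {S = B} {C} B∩C)) ⟩
      card body + (card A + card (B ∪ C))       ≡⟨ cong (card body +_) (sym (card-disjoint-∪ {S = A} {B ∪ C} λ u∈ → ∨-false⁺ (A∩B u∈) (A∩C u∈))) ⟩
      card body + card (A ∪ (B ∪ C))            ≡⟨ sym (card-disjoint-∪ {S = body} {A ∪ (B ∪ C)} (∁-true {S = A ∪ (B ∪ C)})) ⟩
      card (body ∪ (A ∪ (B ∪ C)))               ≤⟨ card≤n (body ∪ (A ∪ (B ∪ C))) ⟩
      n                                         ≤⟨ n≤4δ ⟩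
      4 * δ                                     ∎
      where open ≤-Reasoning

    -- Each leg takes at least `δ + 1` of the at most `4 * δ` vertices.
    body-small : card body + 3 ≤ δ
    body-small = +-cancelʳ-≤ (3 * δ) _ _ (begin
      (card body + 3) + 3 * δ                   ≡⟨ ring (card body) δ ⟩
      card body + (suc δ + (suc δ + suc δ))     ≤⟨ +-monoʳ-≤ (card body) (+-mono-≤ (large s) (+-mono-≤ (large (rotate s)) (large (rotate (rotate s))))) ⟩
      card body + (card A + (card B + card C))  ≤⟨ total ⟩
      4 * δ                                     ∎)
      where
      open ≤-Reasoning
      ring : ∀ m δ → (m + 3) + 3 * δ ≡ m + (suc δ + (suc δ + suc δ))
      ring = solve-∀

    body≤1 : card body ≤ 1
    body≤1 = m*-bound (card body) δ body-small (≤-trans (degree-count body) (+-monoʳ-≤ (card body * card body) ∂≤6))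
      where
      open ≤-Reasoning
      ∂≤6 : ∂ body ≤ 6
      ∂≤6 = begin
        ∂ body               ≡⟨ ∂-∁ (A ∪ (B ∪ C)) ⟩
        ∂ (A ∪ (B ∪ C))      ≤⟨ ∂-∪ A (B ∪ C) ⟩
        ∂ A + ∂ (B ∪ C)      ≤⟨ +-monoʳ-≤ (∂ A) (∂-∪ B C) ⟩
        ∂ A + (∂ B + ∂ C)    ≤⟨ +-mono-≤ ∂A≤2 (+-mono-≤ ∂B≤2 ∂C≤2) ⟩
        6                    ∎

    body≡t : ∀ {u} → body u ≡ true → u ≡ t
    body≡t {u} u∈ with u ≟ t
    ... | yes e = e
    ... | no ne = ⊥-elim (<-irrefl refl (≤-trans (subst (_≤ card body) two (two-terms≤sum (λ v → ⟦ body v ⟧) ne)) body≤1))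
      where
      two : ⟦ body u ⟧ + ⟦ body t ⟧ ≡ 2
      two = cong₂ _+_ (cong ⟦_⟧ u∈) (cong ⟦_⟧ t∈body)

    cover : ∀ {u} → u ≢ t → A u ≡ true ⊎ (B u ≡ true ⊎ C u ≡ true)
    cover {u} u≢t with bool-dichotomy (A u) | bool-dichotomy (B u) | bool-dichotomy (C u)
    ... | inj₁ e | _ | _ = inj₁ e
    ... | _ | inj₁ e | _ = inj₂ (inj₁ e)
    ... | _ | _ | inj₁ e = inj₂ (inj₂ e)
    ... | inj₂ a | inj₂ b | inj₂ c = ⊥-elim (u≢t (body≡t (not-false (∨-false⁺ a (∨-false⁺ b c)))))

    4≤δ : 4 ≤ δ
    4≤δ = ≤-trans (+-monoˡ-≤ 3 (card>0 {S = body} t∈body)) body-small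

    -- The other two legs take at least `δ + 1` vertices each, and `t` takes one.
    leg-small : card A + 3 ≤ δ + δ
    leg-small = +-cancelʳ-≤ (2 * δ) _ _ (begin
      (card A + 3) + 2 * δ                      ≡⟨ ring (card A) δ ⟩
      1 + (card A + (suc δ + suc δ))            ≤⟨ +-mono-≤ (card>0 {S = body} t∈body) (+-monoʳ-≤ (card A) (+-mono-≤ (large (rotate s)) (large (rotate (rotate s))))) ⟩
      card body + (card A + (card B + card C))  ≤⟨ total ⟩
      4 * δ                                     ≡⟨ ring′ δ ⟩
      (δ + δ) + 2 * δ                           ∎)
      where
      open ≤-Reasoning
      ring : ∀ m δ → (m + 3) + 2 * δ ≡ 1 + (m + (suc δ + suc δ))
      ring = solve-∀
      ring′ : ∀ δ → 4 * δ ≡ (δ + δ) + 2 * δ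
      ring′ = solve-∀

    δ≤nbs : δ ≤ nb A t + (nb B t + nb C t)
    δ≤nbs = ≤-trans (δ≤deg t) (≤-trans (≤-reflexive (degree-sum G t))
      (sum₃-≤ {g = λ w → ⟦ A w ∧ adj G t w ⟧} {λ w → ⟦ B w ∧ adj G t w ⟧} {λ w → ⟦ C w ∧ adj G t w ⟧} bound))
      where
      bound : ∀ w → ⟦ adj G t w ⟧ ≤ ⟦ A w ∧ adj G t w ⟧ + (⟦ B w ∧ adj G t w ⟧ + ⟦ C w ∧ adj G t w ⟧)
      bound w with adj G t w in e
      ... | false = z≤n
      ... | true with cover {w} (λ { refl → true≢false e (adj-irr G t) })
      ...   | inj₁ w∈ rewrite w∈ = s≤s z≤n
      ...   | inj₂ (inj₁ w∈) rewrite w∈ = ≤-trans (m≤m+n 1 _) (m≤n+m _ ⟦ A w ∧ true ⟧)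
      ...   | inj₂ (inj₂ w∈) rewrite w∈ = ≤-trans (m≤n+m 1 _) (m≤n+m _ ⟦ A w ∧ true ⟧)

  -- The edges `ta` and `tb` use up the two edges that may leave `L`; `out-a` and `inner` record
  -- this.
  record Cycle (t : Fin n) (L : Sub n) : Set where
    field
      a b c : Fin n
      a≢b  : a ≢ b
      a∈ : L a ≡ true
      b∈ : L b ≡ true
      c∈ : L c ≡ true
      ta : adj G t a ≡ true
      tb : adj G t b ≡ true
      ca : adj G c a ≡ true
      cb : adj G c b ≡ true
      out-a : nb (∁ L) a ≤ 1
      inner : ∀ {u w} → L u ≡ true → u ≢ a → u ≢ b → adj G u w ≡ true → L w ≡ true

  -- Two neighbours of `t` in `A` have at least `δ - 1` neighbours in `A` each. Without a common
  -- one, `A` would have at least `2 * δ - 2` vertices, one more than `leg-small` permits.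
  find-cycle : ∀ {t A B C} → Spider t A B C → 2 ≤ nb A t → Cycle t A
  find-cycle {t} {A} s 2≤nb with find-two (λ w → A w ∧ adj G t w) 2≤nb
  ... | a , b , a≢b , ea , eb with ∧-true {A a} ea | ∧-true {A b} eb
  ...   | a∈ , ta | b∈ , tb = conclude (any? λ c → (A c ≟ᵇ true) ×-dec ((adj G c a ≟ᵇ true) ×-dec (adj G c b ≟ᵇ true)))
    where
    open Spider s
    open ≤-Reasoning
    escape : ∀ {u} → A u ≡ true → adj G t u ≡ true → 1 ≤ ∂ᵥ A u
    escape {u} u∈ tu = card>0 {S = ∂ₑ A u} {t} (∧-true⁺ u∈ (∧-true⁺ (not-false t∉A) (trans (adj-sym G u t) tu)))
    a+b≤2 : ∂ᵥ A a + ∂ᵥ A b ≤ 2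
    a+b≤2 = ≤-trans (two-terms≤sum (∂ᵥ A) a≢b) ∂A≤2
    out-a : nb (∁ A) a ≤ 1
    out-a = subst (_≤ 1) (∂ᵥ-∈ A a∈) (+-cancelʳ-≤ 1 _ _ (≤-trans (+-monoʳ-≤ (∂ᵥ A a) (escape b∈ tb)) a+b≤2))
    out-b : nb (∁ A) b ≤ 1
    out-b = subst (_≤ 1) (∂ᵥ-∈ A b∈) (+-cancelˡ-≤ 1 _ _ (≤-trans (+-monoˡ-≤ (∂ᵥ A b) (escape a∈ ta)) a+b≤2))
    inner : ∀ {u w} → A u ≡ true → u ≢ a → u ≢ b → adj G u w ≡ true → A w ≡ true
    inner {u} {w} u∈ u≢a u≢b uw with bool-dichotomy (A w)
    ... | inj₁ w∈ = w∈
    ... | inj₂ w∉ = ⊥-elim (<-irrefl refl (begin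
      3                                   ≤⟨ +-mono-≤ (card>0 {S = ∂ₑ A u} {w} (∧-true⁺ u∈ (∧-true⁺ (not-false w∉) uw)))
                                                      (+-mono-≤ (escape a∈ ta) (escape b∈ tb)) ⟩
      ∂ᵥ A u + (∂ᵥ A a + ∂ᵥ A b)          ≤⟨ three-terms≤sum (∂ᵥ A) u≢a u≢b a≢b ⟩
      ∂ A                                 ≤⟨ ∂A≤2 ⟩
      2                                   ∎))
    inside : ∀ {u} → nb (∁ A) u ≤ 1 → δ ≤ nb A u + 1
    inside {u} le = begin
      δ                        ≤⟨ δ≤deg u ⟩
      degree G u               ≡⟨ degree-split A u ⟩
      nb A u + nb (∁ A) u      ≤⟨ +-monoʳ-≤ (nb A u) le ⟩
      nb A u + 1               ∎
    conclude : Dec (∃ λ c → A c ≡ true × (adj G c a ≡ true × adj G c b ≡ true)) → Cycle t A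
    conclude (yes (c , c∈ , ca , cb)) = record
      { a = a ; b = b ; c = c ; a≢b = a≢b ; a∈ = a∈ ; b∈ = b∈ ; c∈ = c∈ ; ta = ta ; tb = tb ; ca = ca ; cb = cb
      ; out-a = out-a ; inner = inner }
    conclude (no none) = ⊥-elim (<-irrefl refl (begin-strict
      δ + δ                               ≤⟨ +-mono-≤ (inside out-a) (inside out-b) ⟩
      (nb A a + 1) + (nb A b + 1)         ≡⟨ ring (nb A a) (nb A b) ⟩
      (nb A a + nb A b) + 2               ≡⟨ cong (_+ 2) (sym (∑-distrib-+ (λ w → ⟦ A w ∧ adj G a w ⟧) (λ w → ⟦ A w ∧ adj G b w ⟧))) ⟩
      (sum λ w → ⟦ A w ∧ adj G a w ⟧ + ⟦ A w ∧ adj G b w ⟧) + 2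
                                          ≤⟨ +-monoˡ-≤ 2 (sum-mono-≤ disjoint) ⟩
      card A + 2                          <⟨ ≤-reflexive (sym (+-suc (card A) 2)) ⟩
      card A + 3                          ≤⟨ leg-small s ⟩
      δ + δ                               ∎))
      where
      ring : ∀ p q → (p + 1) + (q + 1) ≡ (p + q) + 2
      ring = solve-∀
      disjoint : ∀ w → ⟦ A w ∧ adj G a w ⟧ + ⟦ A w ∧ adj G b w ⟧ ≤ ⟦ A w ⟧
      disjoint w with A w in ew | adj G a w in ea | adj G b w in eb
      ... | false | _     | _     = z≤n
      ... | true  | true  | true  = ⊥-elim (none (w , ew , trans (adj-sym G w a) ea , trans (adj-sym G w b) eb))
      ... | true  | true  | false = ≤-refl
      ... | true  | false | true  = ≤-refl
      ... | true  | false | false = z≤n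

  spider-cycle : ∀ {t A B C} → Spider t A B C → ∃ λ L → ∃₂ λ B′ C′ → Spider t L B′ C′ × Cycle t L
  spider-cycle {t} {A} {B} {C} s with some≥2 (nb A t) (nb B t) (nb C t) (≤-trans (4≤δ s) (δ≤nbs s))
  ... | inj₁ h = A , B , C , s , find-cycle s h
  ... | inj₂ (inj₁ h) = B , C , A , rotate s , find-cycle (rotate s) h
  ... | inj₂ (inj₂ h) = C , A , B , rotate (rotate s) , find-cycle (rotate (rotate s)) h

  module _ {t L B C} (s : Spider t L B C) (cyc : Cycle t L) where
    open Cycle cyc

    Unsplit : Sub n → Set
    Unsplit F = F a ≡ F t × F b ≡ F t

    -- `F` cannot cut `L` into two nonempty parts, because these would be too large: more than `δ`
    -- vertices outside `F` and at least `δ - 3` inside, against `card L ≤ 2 * δ - 3`.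
    leg⊆ : ∀ {F} → ∂ F ≤ 2 → Unsplit F → F t ≡ true → ∀ {u} → L u ≡ true → F u ≡ true
    leg⊆ {F} ∂F≤2 (Fa , Fb) t∈F {u} u∈L with bool-dichotomy (F u)
    ... | inj₁ u∈F = u∈F
    ... | inj₂ u∉F = ⊥-elim (<-irrefl refl (begin-strict
      (δ + 3) + δ                              <⟨ ≤-reflexive (ring δ) ⟩
      suc δ + (δ + 3)                          ≤⟨ +-mono-≤ X-large (+-monoˡ-≤ 3 δ≤) ⟩
      card X + ((card Y + 3) + 3)              ≡⟨ ring′ (card X) (card Y) ⟩
      (card X + card Y) + 3 + 3                ≡⟨ cong (λ k → k + 3 + 3) (sym (card-disjoint-∪ {S = X} {Y} X∩Y)) ⟩
      card (X ∪ Y) + 3 + 3                     ≤⟨ +-monoˡ-≤ 3 (+-monoˡ-≤ 3 (card-mono XY⊆L)) ⟩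
      card L + 3 + 3                           ≤⟨ +-monoˡ-≤ 3 (leg-small s) ⟩
      δ + δ + 3                                ≡⟨ ring″ δ ⟩
      (δ + 3) + δ                              ∎))
      where
      open ≤-Reasoning
      X Y : Sub n
      X = L ∩ ∁ F
      Y = L ∩ F
      ring : ∀ δ → suc ((δ + 3) + δ) ≡ suc δ + (δ + 3)
      ring = solve-∀
      ring′ : ∀ x y → x + ((y + 3) + 3) ≡ x + y + 3 + 3
      ring′ = solve-∀
      ring″ : ∀ δ → δ + δ + 3 ≡ (δ + 3) + δ
      ring″ = solve-∀
      a∈F : F a ≡ true
      a∈F = trans Fa t∈F
      b∈F : F b ≡ true
      b∈F = trans Fb t∈F
      X∩Y : ∀ {w} → X w ≡ true → Y w ≡ false
      X∩Y {w} w∈ with ∧-true {L w} w∈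
      ... | _ , w∉F = trans (cong (L w ∧_) (∁-true {S = F} w∉F)) (∧-zeroʳ (L w))
      XY⊆L : ∀ w → (X ∪ Y) w ≡ true → L w ≡ true
      XY⊆L w w∈ with ∨-split {X w} w∈
      ... | inj₁ e = proj₁ (∧-true {L w} e)
      ... | inj₂ e = proj₁ (∧-true {L w} e)
      -- The vertices of `X` differ from `a` and `b`, which lie in `F`, so all their neighbours are
      -- in `L`; an edge leaving `X` therefore ends in `F`.
      ∂X≤ : ∂ X ≤ ∂ F
      ∂X≤ = ≤-trans (sum₂-mono λ v w → ⟦⟧-mono (edge v w)) (≤-reflexive (∂-∁ F))
        where
        edge : ∀ v w → ∂ₑ X v w ≡ true → ∂ₑ (∁ F) v w ≡ true
        edge v w e with ∧-true {X v} e
        ... | v∈X , e′ with ∧-true {not (X w)} e′ | ∧-true {L v} v∈X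
        ...   | w∉X , vw | v∈L , v∉F with inner v∈L (λ { refl → true≢false a∈F (∁-true {S = F} v∉F) })
                                                    (λ { refl → true≢false b∈F (∁-true {S = F} v∉F) }) vw
        ...     | w∈L = ∧-true⁺ v∉F (∧-true⁺ (not-false (subst (λ b → b ∧ not (F w) ≡ false) w∈L (∁-true {S = X} w∉X))) vw)
      X-large : δ < card X
      X-large = small-boundary⇒large X (∧-true⁺ u∈L (not-false u∉F)) (<-≤-trans (s≤s (≤-trans ∂X≤ ∂F≤2)) 3≤δ)
      -- Of the neighbours of `a`, at most two lie outside `F` and at most one outside `L`.
      δ≤ : δ ≤ card Y + 3
      δ≤ = begin
        δ                              ≤⟨ δ≤deg a ⟩
        degree G a                     ≤⟨ ≤-trans (≤-reflexive (degree-sum G a))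
                                            (sum₃-≤ {g = λ w → ⟦ Y w ⟧} {λ w → ⟦ not (F w) ∧ adj G a w ⟧} {λ w → ⟦ not (L w) ∧ adj G a w ⟧}
                                               λ w → bound (L w) (F w) (adj G a w)) ⟩
        card Y + (nb (∁ F) a + nb (∁ L) a)  ≤⟨ +-monoʳ-≤ (card Y) (+-mono-≤ (≤-trans (nb-∁≤∂ F a∈F) ∂F≤2) out-a) ⟩
        card Y + 3                     ∎
        where
        bound : ∀ l f e → ⟦ e ⟧ ≤ ⟦ l ∧ f ⟧ + (⟦ not f ∧ e ⟧ + ⟦ not l ∧ e ⟧)
        bound l     f     false = z≤n
        bound true  true  true  = s≤s z≤n
        bound true  false true  = s≤s z≤n
        bound false true  true  = s≤s z≤n
        bound false false true  = s≤s z≤n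

  module _ {t′ A′ B′ C′} (s′ : Spider t′ A′ B′ C′) where
    open Spider s′

    -- A leg of the spider that meets `L` does so in a set with boundary at most `2 + 2 < δ`, hence
    -- in more than `δ` vertices. Only one leg can do this, as `card L < 2 * δ`. The centre then has
    -- at most two neighbours in `L`, all in that leg, and at most two outside `L`.
    centre-∉ : 5 ≤ δ → ∀ {L} → ∂ L ≤ 2 → card L + 3 ≤ δ + δ → L t′ ≡ true → ⊥
    centre-∉ 5≤δ {L} ∂L≤2 small t′∈L =
      <-irrefl refl (≤-trans (s≤s (≤-trans (δ≤deg t′) degree≤4)) 5≤δ)
      where
      open ≤-Reasoning
      part : ∀ F → ∂ F ≤ 2 → F t′ ≡ false → nb (F ∩ L) t′ ≡ 0 ⊎ (nb (F ∩ L) t′ ≤ 2 × δ < card (F ∩ L))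
      part F ∂F≤2 t′∉F with nonempty? (F ∩ L)
      ... | inj₂ empty = inj₁ (nb-empty {F ∩ L} empty t′)
      ... | inj₁ (x , x∈) = inj₂
        ( ≤-trans (nb-mono {F ∩ L} {F} (λ u e → proj₁ (∧-true {F u} e)) t′) (≤-trans (nb≤∂ F t′∉F) ∂F≤2)
        , small-boundary⇒large (F ∩ L) x∈ (≤-trans (s≤s (≤-trans (∂-∩ F L) (+-mono-≤ ∂F≤2 ∂L≤2))) 5≤δ) )
      not-both : ∀ F F′ → (∀ {u} → F u ≡ true → F′ u ≡ false) → δ < card (F ∩ L) → δ < card (F′ ∩ L) → ⊥
      not-both F F′ F∩F′ h h′ = <-irrefl refl (begin-strict
        δ + δ                              <⟨ +-mono-< h h′ ⟩
        card (F ∩ L) + card (F′ ∩ L)       ≡⟨ sym (card-disjoint-∪ {S = F ∩ L} {F′ ∩ L} λ {u} e → cong (_∧ L u) (F∩F′ (proj₁ (∧-true {F u} e)))) ⟩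
        card ((F ∩ L) ∪ (F′ ∩ L))          ≤⟨ card-mono (λ u e → in-L u (∨-split {(F ∩ L) u} e)) ⟩
        card L                             ≤⟨ m≤m+n (card L) 3 ⟩
        card L + 3                         ≤⟨ small ⟩
        δ + δ                              ∎)
        where
        in-L : ∀ u → (F ∩ L) u ≡ true ⊎ (F′ ∩ L) u ≡ true → L u ≡ true
        in-L u (inj₁ e) = proj₂ (∧-true {F u} e)
        in-L u (inj₂ e) = proj₂ (∧-true {F′ u} e)
      parts≤2 : nb (A′ ∩ L) t′ + (nb (B′ ∩ L) t′ + nb (C′ ∩ L) t′) ≤ 2
      parts≤2 with part A′ ∂A≤2 t∉A | part B′ ∂B≤2 t∉B | part C′ ∂C≤2 t∉C
      ... | inj₁ a | inj₁ b | inj₁ c rewrite a | b | c = z≤n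
      ... | inj₁ a | inj₁ b | inj₂ (c , _) rewrite a | b = c
      ... | inj₁ a | inj₂ (b , _) | inj₁ c rewrite a | c | +-identityʳ (nb (B′ ∩ L) t′) = b
      ... | inj₂ (a , _) | inj₁ b | inj₁ c rewrite b | c | +-identityʳ (nb (A′ ∩ L) t′) = a
      ... | inj₂ (_ , a) | inj₂ (_ , b) | _ = ⊥-elim (not-both A′ B′ A∩B a b)
      ... | inj₂ (_ , a) | _ | inj₂ (_ , c) = ⊥-elim (not-both A′ C′ A∩C a c)
      ... | _ | inj₂ (_ , b) | inj₂ (_ , c) = ⊥-elim (not-both B′ C′ B∩C b c)
      inside : nb L t′ ≤ nb (A′ ∩ L) t′ + (nb (B′ ∩ L) t′ + nb (C′ ∩ L) t′)
      inside = sum₃-≤ {g = λ w → ⟦ (A′ w ∧ L w) ∧ adj G t′ w ⟧} {λ w → ⟦ (B′ w ∧ L w) ∧ adj G t′ w ⟧} {λ w → ⟦ (C′ w ∧ L w) ∧ adj G t′ w ⟧} bound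
        where
        bound : ∀ w → ⟦ L w ∧ adj G t′ w ⟧ ≤ ⟦ (A′ w ∧ L w) ∧ adj G t′ w ⟧ + (⟦ (B′ w ∧ L w) ∧ adj G t′ w ⟧ + ⟦ (C′ w ∧ L w) ∧ adj G t′ w ⟧)
        bound w with adj G t′ w in e
        ... | false rewrite ∧-zeroʳ (L w) = z≤n
        ... | true with cover s′ {w} (λ { refl → true≢false e (adj-irr G t′) })
        ...   | inj₁ w∈ rewrite w∈ = m≤m+n _ _
        ...   | inj₂ (inj₁ w∈) rewrite w∈ = ≤-trans (m≤m+n _ _) (m≤n+m _ ⟦ (A′ w ∧ L w) ∧ true ⟧)
        ...   | inj₂ (inj₂ w∈) rewrite w∈ = ≤-trans (m≤n+m _ _) (m≤n+m _ ⟦ (A′ w ∧ L w) ∧ true ⟧)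
      degree≤4 : degree G t′ ≤ 4
      degree≤4 = begin
        degree G t′                ≡⟨ degree-split L t′ ⟩
        nb L t′ + nb (∁ L) t′      ≤⟨ +-mono-≤ (≤-trans inside parts≤2) (≤-trans (nb-∁≤∂ L t′∈L) ∂L≤2) ⟩
        4                          ∎

  module _ {t L B C} (s : Spider t L B C) (cyc : Cycle t L) where

    no-spider-at : ∀ {t′ A′ B′ C′} → Spider t′ A′ B′ C′ → Unsplit s cyc A′ → A′ t ≡ true → ⊥
    no-spider-at {t′} {A′} {B′} {C′} s′ unsplit t∈A′ = somewhere (cover s t′≢t)
      where
      open ≤-Reasoning
      t′≢t : t′ ≢ t
      t′≢t refl = true≢false t∈A′ (Spider.t∉A s′)
      -- `A′` contains the leg `L`, which has at least `δ + 1` vertices, and also `t`. This extra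
      -- vertex raises the bound `4 ≤ δ` of an arbitrary spider to `5 ≤ δ`.
      A′-large : suc (suc δ) ≤ card A′
      A′-large = ≤-trans (s≤s (large s))
        (card-mono-< {S = L} {A′} (λ u → leg⊆ s cyc (Spider.∂A≤2 s′) unsplit t∈A′) t (Spider.t∉A s) t∈A′)
      5≤δ : 5 ≤ δ
      5≤δ = +-cancelʳ-≤ (3 * δ) _ _ (begin
        5 + 3 * δ                                                  ≡⟨ ring δ ⟩
        1 + (suc (suc δ) + (suc δ + suc δ))                        ≤⟨ +-mono-≤ (card>0 {S = body s′} (t∈body s′))
                                                                        (+-mono-≤ A′-large (+-mono-≤ (large (rotate s′)) (large (rotate (rotate s′))))) ⟩
        card (body s′) + (card A′ + (card B′ + card C′))           ≤⟨ total s′ ⟩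
        4 * δ                                                      ∎)
        where
        ring : ∀ δ → 5 + 3 * δ ≡ 1 + (suc (suc δ) + (suc δ + suc δ))
        ring = solve-∀
      somewhere : L t′ ≡ true ⊎ (B t′ ≡ true ⊎ C t′ ≡ true) → ⊥
      somewhere (inj₁ e)        = centre-∉ s′ 5≤δ (Spider.∂A≤2 s) (leg-small s) e
      somewhere (inj₂ (inj₁ e)) = centre-∉ s′ 5≤δ (Spider.∂B≤2 s) (leg-small (rotate s)) e
      somewhere (inj₂ (inj₂ e)) = centre-∉ s′ 5≤δ (Spider.∂C≤2 s) (leg-small (rotate (rotate s))) e

    no-unsplit-spider : ∀ {t′ A′ B′ C′} → Spider t′ A′ B′ C′ →
                        Unsplit s cyc A′ → Unsplit s cyc B′ → Unsplit s cyc C′ → ⊥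
    no-unsplit-spider {t′} {A′} {B′} {C′} s′ uA uB uC
      with bool-dichotomy (A′ t) | bool-dichotomy (B′ t) | bool-dichotomy (C′ t)
    ... | inj₁ e | _ | _ = no-spider-at s′ uA e
    ... | _ | inj₁ e | _ = no-spider-at (rotate s′) uB e
    ... | _ | _ | inj₁ e = no-spider-at (rotate (rotate s′)) uC e
    -- If no leg contains `t`, none contains `a` either; both lie in the body, a single vertex,
    -- although they are adjacent.
    ... | inj₂ eA | inj₂ eB | inj₂ eC = true≢false ta (trans (cong (adj G t) a≡t) (adj-irr G t))
      where
      open Cycle cyc
      a≡t : a ≡ t
      a≡t = trans (body≡t s′ (not-false (∨-false⁺ (trans (proj₁ uA) eA) (∨-false⁺ (trans (proj₁ uB) eB) (trans (proj₁ uC) eC)))))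
                  (sym (body≡t s′ (not-false (∨-false⁺ eA (∨-false⁺ eB eC)))))

-- `1 + (n - 1) / 4` for positive `n`. It stands in for the minimum degree: an integer below every
-- degree that still satisfies `n ≤ 4 * δ`.
⌈_/4⌉ : ℕ → ℕ
⌈ zero  /4⌉ = 0
⌈ suc m /4⌉ = suc (m / 4)

n≤4*⌈n/4⌉ : ∀ n → n ≤ 4 * ⌈ n /4⌉
n≤4*⌈n/4⌉ zero    = z≤n
n≤4*⌈n/4⌉ (suc m) = begin
  suc m                    ≡⟨ cong suc (m≡m%n+[m/n]*n m 4) ⟩
  suc (m % 4) + m / 4 * 4  ≤⟨ +-monoˡ-≤ (m / 4 * 4) (m%n<n m 4) ⟩
  suc (m / 4) * 4          ≡⟨ *-comm (suc (m / 4)) 4 ⟩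
  4 * suc (m / 4)          ∎
  where open ≤-Reasoning

⌈n/4⌉-least : ∀ n d → n ≤ 4 * d → ⌈ n /4⌉ ≤ d
⌈n/4⌉-least zero    d _  = z≤n
⌈n/4⌉-least (suc m) d le = m<n*o⇒m/o<n (subst (m <_) (*-comm 4 d) le)

connected⇒closed-full : ∀ {n} (G : Graph n) → Connected G → ∀ (S : Sub n) {x} → S x ≡ true →
                        (∀ {u v} → S u ≡ true → adj G u v ≡ true → S v ≡ true) → ∀ u → S u ≡ true
connected⇒closed-full {n} G conn S {x} x∈ closed u with conn x u
... | a ∷ p , w , _ , refl , e = along a p w e x∈
  where
  along : ∀ a p → Walk G (a ∷ p) → last (a ∷ p) ≡ just u → S a ≡ true → S u ≡ true
  along a []      _       refl a∈ = a∈
  along a (b ∷ p) (h , w) e    a∈ = along b p w e (closed a∈ h)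

-- Choosing the cut

module Main {n δ : ℕ} (G : Graph n) (conn : Connected G) (r : Fin n)
            (δ≤deg : ∀ v → δ ≤ degree G v) (n≤4δ : n ≤ 4 * δ) (3≤δ : 3 ≤ δ) where
  open Boundary G
  open MaxCut G
  open Spiders G δ≤deg n≤4δ 3≤δ

  module _ (f : Sub n) where
    open Cut G f

    Closed : Sub n → Set
    Closed S = ∀ {u v} → S u ≡ true → cutEdge u v ≡ true → S v ≡ true

    tripod⇒spider : (T : Tripod) → (∀ {S} → OneExit S → ∂ S ≤ 2) → Spider (Tripod.t T) (Tripod.F T 0F) (Tripod.F T 1F) (Tripod.F T 2F)
    tripod⇒spider T ∂≤2 = record
      { A∩B = λ {u} → disj (λ ()) u ; A∩C = λ {u} → disj (λ ()) u ; B∩C = λ {u} → disj (λ ()) u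
      ; t∉A = t∉ 0F ; t∉B = t∉ 1F ; t∉C = t∉ 2F
      ; A≢∅ = side 0F ; B≢∅ = side 1F ; C≢∅ = side 2F
      ; ∂A≤2 = ∂≤2 (exit 0F) ; ∂B≤2 = ∂≤2 (exit 1F) ; ∂C≤2 = ∂≤2 (exit 2F) }
      where
      open Tripod T
      side : ∀ i → ∃ λ u → F i u ≡ true
      side i = OneExit.inner (exit i) , OneExit.inner∈ (exit i)

    -- Maximality is asked only against the flips that are actually made, so that constrained cuts
    -- qualify as well.
    module _ (stable : ∀ S → OneExit S ⊎ Closed S → cutSize (f ⊕ S) ≤ cutSize f) where

      ∂-OneExit : ∀ {S} → OneExit S → ∂ S ≤ 2
      ∂-OneExit {S} ξ = ≤-trans (∂≤crossing f S (stable S (inj₁ ξ))) (crossing-OneExit f S ξ)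

      -- A set closed in H has no cut edge on its boundary. By maximality it has no boundary in `G`
      -- either, and `G` is connected.
      cut-connected : HConnected
      cut-connected S x∈ closed = connected⇒closed-full G conn S x∈ (∂≡0⇒closed S
        (n≤0⇒n≡0 (≤-trans (∂≤crossing f S (stable S (inj₂ closed))) (≤-reflexive (crossing-closed f S closed)))))

      coloured-or-tripod : ProperlyConnectedWith G 2 ⊎ Tripod
      coloured-or-tripod with unilateral-or-tripod cut-connected r
      ... | inj₁ U = inj₁ (unilateral⇒pc G f U)
      ... | inj₂ T = inj₂ T

  module Constrained {t L B C} (s : Spider t L B C) (cyc : Cycle t L) where
    open Cycle cyc

    -- All four edges of the cycle are cut. This can be met because the cycle has even length: put
    -- `t` and `c` on one side, `a` and `b` on the other.
    K : Sub n → Set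
    K f = (f t xor f a ≡ true × f t xor f b ≡ true) × (f c xor f a ≡ true × f c xor f b ≡ true)

    K? : ∀ f → Dec (K f)
    K? f = (((f t xor f a) ≟ᵇ true) ×-dec ((f t xor f b) ≟ᵇ true)) ×-dec (((f c xor f a) ≟ᵇ true) ×-dec ((f c xor f b) ≟ᵇ true))

    K-resp : ∀ {f g} → f ≗ g → K f → K g
    K-resp {f} {g} e ((ta , tb) , (ca , cb)) = (go t a ta , go t b tb) , (go c a ca , go c b cb)
      where
      go : ∀ u v → f u xor f v ≡ true → g u xor g v ≡ true
      go u v h = trans (sym (cong₂ _xor_ (e u) (e v))) h

    adj⇒≢ : ∀ {u v} → adj G u v ≡ true → u ≢ v
    adj⇒≢ {u} uv refl = true≢false uv (adj-irr G u)

    t≢c : t ≢ c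
    t≢c refl = true≢false c∈ (Spider.t∉A s)

    K-start : ∃ K
    K-start = f , (edge t a t∈ a∉ , edge t b t∈ b∉) , (edge c a c∈f a∉ , edge c b c∈f b∉)
      where
      f : Sub n
      f = ⁅ t ⁆ ∪ ⁅ c ⁆
      t∈ : f t ≡ true
      t∈ = ∨-true₁ _ (⁅⁆-self t)
      c∈f : f c ≡ true
      c∈f = ∨-true₂ (⁅ t ⁆ c) (⁅⁆-self c)
      a∉ : f a ≡ false
      a∉ = ∨-false⁺ (⁅⁆-false (adj⇒≢ ta ∘ sym)) (⁅⁆-false (adj⇒≢ ca ∘ sym))
      b∉ : f b ≡ false
      b∉ = ∨-false⁺ (⁅⁆-false (adj⇒≢ tb ∘ sym)) (⁅⁆-false (adj⇒≢ cb ∘ sym))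
      edge : ∀ u v → f u ≡ true → f v ≡ false → f u xor f v ≡ true
      edge u v eu ev = cong₂ _xor_ eu ev

    Constant : Sub n → Set
    Constant S = S a ≡ S t × (S b ≡ S t × S c ≡ S t)

    K-flip : ∀ f S → Constant S → K f → K (f ⊕ S)
    K-flip f S (ea , eb , ec) ((ta , tb) , (ca , cb)) =
      (go t a (sym ea) ta , go t b (sym eb) tb) , (go c a (trans ec (sym ea)) ca , go c b (trans ec (sym eb)) cb)
      where
      cancel : ∀ x y z → (x xor z) xor (y xor z) ≡ x xor y
      cancel true  true  true  = refl
      cancel true  true  false = refl
      cancel true  false true  = refl
      cancel true  false false = refl
      cancel false true  true  = refl
      cancel false true  false = refl
      cancel false false true  = refl
      cancel false false false = refl
      go : ∀ u v → S u ≡ S v → f u xor f v ≡ true → (f ⊕ S) u xor (f ⊕ S) v ≡ true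
      go u v e h = trans (cong (λ z → (f u xor z) xor (f v xor S v)) e) (trans (cancel (f u) (f v) (S v)) h)

    module _ (f : Sub n) (k : K f) where
      open Cut G f

      private
        Hta : cutEdge t a ≡ true
        Hta = ∧-true⁺ ta (proj₁ (proj₁ k))
        Htb : cutEdge t b ≡ true
        Htb = ∧-true⁺ tb (proj₂ (proj₁ k))
        Hca : cutEdge c a ≡ true
        Hca = ∧-true⁺ ca (proj₁ (proj₂ k))
        Hcb : cutEdge c b ≡ true
        Hcb = ∧-true⁺ cb (proj₂ (proj₂ k))
        back : ∀ {u v} → cutEdge u v ≡ true → cutEdge v u ≡ true
        back {u} {v} h = trans (cutEdge-sym v u) h

      closed-constant : ∀ {S} → Closed f S → Constant S
      closed-constant {S} closed = sym (same Hta) , sym (same Htb) , trans (same Hca) (sym (same Hta))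
        where
        same : ∀ {u v} → cutEdge u v ≡ true → S u ≡ S v
        same {u} {v} h with S u in eu | S v in ev
        ... | true  | true  = refl
        ... | false | false = refl
        ... | true  | false = ⊥-elim (true≢false (closed eu h) ev)
        ... | false | true  = ⊥-elim (true≢false (closed ev (back h)) eu)

      -- A cycle that crosses the boundary of S does so at least twice.
      oneExit-constant : ∀ {S} → OneExit S → Constant S
      oneExit-constant {S} ξ = cases (bool-dichotomy (S t)) (bool-dichotomy (S a)) (bool-dichotomy (S b)) (bool-dichotomy (S c))
        where
        open OneExit ξ
        tails : ∀ {u v u′ v′ : Fin n} {X : Set} → u ≢ u′ → S u ≡ true → S v ≡ false → cutEdge u v ≡ true →
                S u′ ≡ true → S v′ ≡ false → cutEdge u′ v′ ≡ true → X
        tails ne p q h p′ q′ h′ = ⊥-elim (ne (trans (proj₁ (only p q h)) (sym (proj₁ (only p′ q′ h′)))))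
        heads : ∀ {u v u′ v′ : Fin n} {X : Set} → v ≢ v′ → S u ≡ true → S v ≡ false → cutEdge u v ≡ true →
                S u′ ≡ true → S v′ ≡ false → cutEdge u′ v′ ≡ true → X
        heads ne p q h p′ q′ h′ = ⊥-elim (ne (trans (proj₂ (only p q h)) (sym (proj₂ (only p′ q′ h′)))))
        cases : S t ≡ true ⊎ S t ≡ false → S a ≡ true ⊎ S a ≡ false → S b ≡ true ⊎ S b ≡ false → S c ≡ true ⊎ S c ≡ false → Constant S
        cases (inj₁ pt) (inj₁ pa) (inj₁ pb) (inj₁ pc) = trans pa (sym pt) , trans pb (sym pt) , trans pc (sym pt)
        cases (inj₂ pt) (inj₂ pa) (inj₂ pb) (inj₂ pc) = trans pa (sym pt) , trans pb (sym pt) , trans pc (sym pt)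
        cases (inj₁ pt) (inj₂ pa) (inj₂ pb) _         = heads a≢b pt pa Hta pt pb Htb
        cases (inj₁ pt) (inj₂ pa) (inj₁ pb) (inj₂ pc) = tails (adj⇒≢ tb) pt pa Hta pb pc (back Hcb)
        cases (inj₁ pt) (inj₂ pa) (inj₁ pb) (inj₁ pc) = tails t≢c pt pa Hta pc pa Hca
        cases (inj₂ pt) (inj₁ pa) (inj₁ pb) _         = tails a≢b pa pt (back Hta) pb pt (back Htb)
        cases (inj₂ pt) (inj₁ pa) (inj₂ pb) (inj₁ pc) = tails (adj⇒≢ ca ∘ sym) pa pt (back Hta) pc pb Hcb
        cases (inj₂ pt) (inj₁ pa) (inj₂ pb) (inj₂ pc) = heads t≢c pa pt (back Hta) pa pc (back Hca)
        cases (inj₁ pt) (inj₁ pa) (inj₁ pb) (inj₂ pc) = tails a≢b pa pc (back Hca) pb pc (back Hcb)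
        cases (inj₁ pt) (inj₁ pa) (inj₂ pb) (inj₂ pc) = tails (adj⇒≢ ta) pt pb Htb pa pc (back Hca)
        cases (inj₁ pt) (inj₁ pa) (inj₂ pb) (inj₁ pc) = tails t≢c pt pb Htb pc pb Hcb
        cases (inj₂ pt) (inj₂ pa) (inj₂ pb) (inj₁ pc) = heads a≢b pc pa Hca pc pb Hcb
        cases (inj₂ pt) (inj₂ pa) (inj₁ pb) (inj₁ pc) = tails (adj⇒≢ cb) pc pa Hca pb pt (back Htb)
        cases (inj₂ pt) (inj₂ pa) (inj₁ pb) (inj₂ pc) = heads t≢c pb pt (back Htb) pb pc (back Hcb)

    coloured : ProperlyConnectedWith G 2
    coloured with max-cut K K? K-resp K-start
    ... | f , k , max = conclude (coloured-or-tripod f stable)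
      where
      open Cut G f
      -- Both kinds of sets are constant on the cycle, so the flipped cut still satisfies `K` and is
      -- among the competitors of `f`.
      stable : ∀ S → OneExit S ⊎ Closed f S → cutSize (f ⊕ S) ≤ cutSize f
      stable S (inj₁ ξ)  = max (f ⊕ S) (K-flip f S (oneExit-constant f k ξ) k)
      stable S (inj₂ cl) = max (f ⊕ S) (K-flip f S (closed-constant f k {S} cl) k)
      conclude : ProperlyConnectedWith G 2 ⊎ Tripod → ProperlyConnectedWith G 2
      conclude (inj₁ pc) = pc
      conclude (inj₂ T) = ⊥-elim (no-unsplit-spider s cyc (tripod⇒spider f T (∂-OneExit f stable)) (unsplit 0F) (unsplit 1F) (unsplit 2F))
        where
        unsplit : ∀ i → Unsplit s cyc (Tripod.F T i)
        unsplit i = let ea , eb , _ = oneExit-constant f k (Tripod.exit T i) in ea , eb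

  coloured : ProperlyConnectedWith G 2
  coloured with max-cut (λ _ → ⊤) (λ _ → yes tt) (λ _ _ → tt) (⁅ r ⁆ , tt)
  ... | f , _ , max with coloured-or-tripod f (λ S _ → max (f ⊕ S) tt)
  ...   | inj₁ pc = pc
  ...   | inj₂ T with spider-cycle (tripod⇒spider f T (∂-OneExit f λ S _ → max (f ⊕ S) tt))
  ...     | _ , _ , _ , s , cyc = Constrained.coloured s cyc

theorem7 : ∀ (n : ℕ) (G : Graph n) → 9 ≤ n → Connected G → (Complete G → ⊥) → MinDegreeAtLeastQuarter G → pc≡ G 2
theorem7 n@(suc _) G 9≤n conn nc mindeg =
  Main.coloured {δ = ⌈ n /4⌉} G conn 0F (λ v → ⌈n/4⌉-least n (degree G v) (mindeg v)) (n≤4*⌈n/4⌉ n) 3≤δ ,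
  pc≥2 G (≤-trans (s≤s (s≤s z≤n)) 9≤n) nc
  where
  3≤δ : 3 ≤ ⌈ n /4⌉
  -- A value of at most 2 would give `n ≤ 8`.
  3≤δ = ≮⇒≥ λ lt → <⇒≱ (≤-<-trans (*-monoʳ-≤ 4 (≤-pred lt)) 9≤n) (n≤4*⌈n/4⌉ n)
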